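{- Let $d\ge 0$ be an integer, let $F$ be a minimum linear forest of a $d$-regular graph $G$, and let $X \subseteq \operatorname{End}(F)$ be a sub-multiset. Then $$|C(F,X)| \ge \frac{d+1}{4}\cdot |\operatorname{End}(F)\setminus X| .$$
   Context: Graphs are finite and simple. A linear forest of a graph $G$ is a subgraph of $G$ that is a collection of vertex-disjoint paths (a single vertex counts as a path); every linear forest is assumed to be spanning, i.e. to contain all vertices of $G$. A minimum linear forest of $G$ is a linear forest with the minimum number of paths (components) among all linear forests of $G$. $\operatorname{End}(F)$ is the multiset of endpoints of the paths of $F$, where an isolated vertex of $F$ is contained twice in $\operatorname{End}(F)$. Inclusion, difference and cardinality of (sub-)multisets of $\operatorname{End}(F)$ are taken with multiplicity. Rotations: Let $F$ be a linear forest of $G$, $v$ an endpoint of $F$, and $u$ a neighbour of $v$ in $G$. If $u$ and $v$ are on the same path of $F$, let $w$ be the neighbour of $u$ on that path that is closer to $v$ (possibly $w=v$). Otherwise, let $w$ be any neighbour of $u$ on its path in $F$ (if $u$ is isolated in $F$ there is no such $w$ and no rotation). The linear forest $F'$ obtained from $F$ by removing the edge $uw$ and adding the edge $uv$ is a rotation of $F$, which rotates the old endpoint $v$ to the new endpoint $w$; then $\operatorname{End}(F')=(\operatorname{End}(F)\setminus\{v\})\cup\{w\}$ as multisets. For a sub-multiset $X\subseteq \operatorname{End}(F)$ (the fixed endpoints), $\mathcal{F}(F,X)$ is the family of all linear forests obtained from $F$ by a (possibly empty) finite sequence of rotations that never rotates an endpoint of $X$; that is, at each step the old endpoint $v$ of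 the rotation of the current forest $F_j$ belongs to the multiset difference $\operatorname{End}(F_j)\setminus X$ (so if $v$ is once in $X$ but twice in $\operatorname{End}(F_j)$, one copy of $v$ may be rotated). Define the set of vertices $$C(F,X) = \bigcup_{F'\in\mathcal{F}(F,X)} \operatorname{End}(F')\setminus X,$$ i.e. the set of vertices occurring in the multiset difference $\operatorname{End}(F')\setminus X$ for some $F'\in\mathcal{F}(F,X)$. -}

module Defs where

open import Algebra.Properties.CommutativeMonoid.Sum using (sum)
open import Data.Fin.Base using (Fin)
open import Data.Fin.Properties using (_≟_)
open import Data.List.Base using (List; []; _∷_; _++_; allFin; concat; concatMap; filter; length; map; reverse)
open import Data.List.Membership.Propositional using (_∈_)
open import Data.List.NonEmpty.Base using (List⁺; head; last; toList)
open import Data.List.Relation.Unary.All using (All)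
open import Data.List.Relation.Unary.Linked using (Linked)
open import Data.List.Relation.Unary.Unique.Propositional using (Unique)
open import Data.Nat.Base using (ℕ; _∸_; _≤_; _<_)
open import Data.Nat.Properties using (+-0-commutativeMonoid)
open import Data.Product.Base using (∃-syntax; _×_)
open import Data.Sum.Base using (_⊎_)
open import Function.Bundles using (_⇔_)
open import Level using (0ℓ)
open import Relation.Binary.Construct.Closure.ReflexiveTransitive using (Star)
open import Relation.Binary.Core using (Rel)
open import Relation.Binary.Definitions using (Decidable; Irreflexive; Symmetric)
open import Relation.Binary.PropositionalEquality.Core using (_≡_)
open import Relation.Nullary.Negation.Core using (¬_)

record Graph (n : ℕ) : Set₁ where
  field
    _~_      : Rel (Fin n) 0ℓ
    _~?_     : Decidable _~_
    ~-sym    : Symmetric _~_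
    ~-irrefl : Irreflexive _≡_ _~_

  degree : Fin n → ℕ
  degree v = length (filter (v ~?_) (allFin n))

  Regular : ℕ → Set
  Regular d = ∀ v → degree v ≡ d

-- A finite multiset of vertices is given by its multiplicity function.
Multiset : ℕ → Set
Multiset n = Fin n → ℕ

module _ {n : ℕ} where

  infix 4 _∈ₘ_ _⊆ₘ_
  infixl 6 _∖_

  _∈ₘ_ : Fin n → Multiset n → Set
  v ∈ₘ M = 0 < M v

  _⊆ₘ_ : Multiset n → Multiset n → Set
  M ⊆ₘ N = ∀ v → M v ≤ N v

  _∖_ : Multiset n → Multiset n → Multiset n
  (M ∖ N) v = M v ∸ N v

  ∣_∣ₘ : Multiset n → ℕ
  ∣ M ∣ₘ = sum +-0-commutativeMonoid M

  multiset : List (Fin n) → Multiset n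
  multiset xs v = length (filter (v ≟_) xs)

module _ {n : ℕ} (G : Graph n) where
  open Graph G

  -- A spanning linear forest, presented by the vertex sequences of its paths.
  -- The order of the paths and the direction in which each is listed carry no
  -- meaning.  Uniqueness in the concatenation says both that no path repeats
  -- a vertex and that distinct paths are disjoint.
  record LinearForest : Set where
    field
      paths    : List (List⁺ (Fin n))
      inGraph  : All (λ p → Linked _~_ (toList p)) paths
      disjoint : Unique (concat (map toList paths))
      spanning : ∀ v → v ∈ concat (map toList paths)

module _ {n : ℕ} {G : Graph n} where
  open Graph G
  open LinearForest

  #paths : LinearForest G → ℕ
  #paths F = length (paths F)

  Minimum : LinearForest G → Set
  Minimum F = ∀ (F′ : LinearForest G) → #paths F ≤ #paths F′

  -- A one-vertex path has equal head and last, so contributes its vertex twice.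
  End : LinearForest G → Multiset n
  End F = multiset (concatMap (λ p → head p ∷ last p ∷ []) (paths F))

  -- xs is the vertex sequence of a path of F, read in either direction.
  Traverses : LinearForest G → List (Fin n) → Set
  Traverses F xs = ∃[ p ] p ∈ paths F × (xs ≡ toList p ⊎ xs ≡ reverse (toList p))

  Edge : LinearForest G → Fin n → Fin n → Set
  Edge F x y = ∃[ xs ] ∃[ ys ] Traverses F (xs ++ x ∷ y ∷ ys)

  SamePath : LinearForest G → Fin n → Fin n → Set
  SamePath F x y = ∃[ p ] p ∈ paths F × x ∈ toList p × y ∈ toList p

  SamePair : (x y a b : Fin n) → Set
  SamePair x y a b = (x ≡ a × y ≡ b) ⊎ (x ≡ b × y ≡ a)

  -- The admissible w when the endpoint v is rotated using its neighbour u.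
  -- On a common path, w is the predecessor of u when reading the path from v
  -- (xs may be empty, and then w is v itself).
  data NewEnd (F : LinearForest G) (v u w : Fin n) : Set where
    same  : ∀ {xs ys zs} → Traverses F (v ∷ zs) → v ∷ zs ≡ xs ++ w ∷ u ∷ ys → NewEnd F v u w
    other : ¬ SamePath F u v → Edge F u w → NewEnd F v u w

  -- F′ is a rotation of F with old endpoint v.  The edge set of F′ is
  -- (E(F) − uw) + uv, so uv survives when w is v.
  record Rotation (F : LinearForest G) (v : Fin n) (F′ : LinearForest G) : Set where
    field
      {u w}    : Fin n
      endpoint : v ∈ₘ End F
      adjacent : v ~ u
      newEnd   : NewEnd F v u w
      edges    : ∀ x y → Edge F′ x y ⇔ ((Edge F x y × ¬ SamePair x y u w) ⊎ SamePair x y u v)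

  RotationFixing : Multiset n → Rel (LinearForest G) 0ℓ
  RotationFixing X F F′ = ∃[ v ] v ∈ₘ (End F ∖ X) × Rotation F v F′

  -- Membership of F′ in the family of forests obtained from F with X fixed.
  Family : LinearForest G → Multiset n → LinearForest G → Set
  Family F X F′ = Star (RotationFixing X) F F′

  C : LinearForest G → Multiset n → Fin n → Set
  C F X v = ∃[ F′ ] Family F X F′ × v ∈ₘ (End F′ ∖ X)

{-# OPTIONS --safe #-}
module Submission where

-- Call an endpoint free if it lies in the multiset End F minus X.  The proof
-- is by induction on the number k of free endpoints, which rotations do not
-- change.  Write C for C(F, X), c(u) for the number of neighbours of u in C
-- in the graph, and f(u) for the number of its neighbours in C along F.
--
-- Rotations (Closure).  Ends of distinct paths of a minimum forest are not
-- adjacent (minimum-join).  So if v is a free endpoint adjacent to u, then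
-- some neighbour of u in the current forest is in C (free-neighbour), and if
-- two free endpoints are adjacent to u, then two different ones are
-- (two-free-neighbours).  A rotation at u replaces a neighbour w of u by v,
-- where v and w are in C; hence a vertex that has no neighbour, or at most one,
-- in C along the current forest stays so until it is rotated itself.
--
-- Fixing endpoints (no-gain).  If fixing j more endpoints of some forest of
-- the family makes at least (d+1)j/4 vertices of C unreachable, then the
-- induction hypothesis gives the bound.  Suppose that the bound fails, so
-- that this never happens.
--   * For u in C, make u an endpoint and fix it; if a vertex of the closed
--     neighbourhood N[u] is then still reachable, make it an endpoint and fix
--     it as well.  These two are then the ends of one path, and no other free
--     endpoint enters N[u] (crowded), so c(u) + 1 < (d+1)/2 (c-inside).
--   * Let f(u) be at most 1, and let x in C be adjacent to u, where u is
--     outside C or f(x) = 0.  Then u cannot become free while x is free, and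
--     fixing x makes all neighbours of u unreachable (frozen), so
--     c(u) < (d+1)/4 (c-none).
--
-- Counting (contradictory).  Let D be the set of those x in C with f(x) = 0;
-- no two vertices of D are adjacent (none-independent).  In the sum of c(u)
-- over all u, which is d |C|, for each u in D transfer the contribution of
-- each neighbour x in C from u to x.  Afterwards every vertex u carries at
-- most d f(u) / 2: a vertex of D carries nothing; a vertex of C with f(u) at
-- least 2 carries at most 2 c(u), and c(u) is below d / 2; a vertex outside C
-- carries c(u), which is at most d, and is 0 if f(u) = 0 (outside-none); and
-- the vertices with f(u) = 1 are controlled by the two bounds above.  Since
-- the sum of f(u) is the sum of the forest degrees over C, which is less than
-- 2 |C| because C contains an endpoint of F, this says d |C| < d |C|.
--
-- As C must be given as a finite subset, membership in it has to be decided: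
-- a forest matters only through its list of paths, there are finitely many
-- such lists, and reachability in a finite graph is decidable (star?).

open import Data.Empty using (⊥)
open import Data.Fin.Base using (Fin; zero; suc)
open import Data.Fin.Properties using (_≟_; any?; all?)
open import Data.Fin.Subset using (∣_∣; _∈_)
open import Data.List.Base using (List; []; _∷_; _++_; allFin; cartesianProductWith; concat; concatMap; filter; length; map; reverse; tabulate)
open import Data.List.Membership.Propositional using (find) renaming (_∈_ to _∈ₗ_; _∉_ to _∉ₗ_)
open import Data.List.Membership.Propositional.Properties using (∈-++⁺ˡ; ∈-++⁺ʳ; ∈-∃++; ∈-allFin; ∈-cartesianProductWith⁺; ∈-concat⁺′; ∈-concat⁻′; ∈-map⁺; ∈-map⁻)
open import Data.List.NonEmpty.Base as List⁺ using (List⁺; _∷_; _++⁺_; head; last; snocView; _∷ʳ′_; toList)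
open import Data.List.Properties using (++-assoc; ∷ʳ-injectiveʳ; ∷-injectiveˡ; ∷-injectiveʳ; length-++; length-tabulate; reverse-++; reverse-involutive; unfold-reverse; ≡-dec)
open import Data.List.Relation.Binary.Permutation.Propositional using (_↭_; ↭⇒↭ₛ; ↭-refl; ↭-sym; ↭-trans; ↭-reflexive; prep)
import Data.List.Relation.Binary.Permutation.Propositional.Properties as Perm
open Perm using (Any-resp-↭; ∈-resp-↭; ↭-reverse; ↭-length)
open import Data.List.Relation.Binary.Permutation.Setoid.Properties using (Unique-resp-↭)
open import Data.List.Relation.Unary.All as All using (All; []; _∷_)
open import Data.List.Relation.Unary.AllPairs using ([]; _∷_)
open import Data.List.Relation.Unary.Any as Any using (Any; here; there)
open import Data.List.Relation.Unary.Linked as Linked using (Linked; []; [-]; _∷_; linked?)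
open import Data.List.Relation.Unary.Unique.Propositional using (Unique)
open import Data.List.Relation.Unary.Unique.DecPropositional using (unique?)
open import Data.Nat.Base using (ℕ; zero; suc; _+_; _*_; _∸_; _≤_; _<_; z≤n; s≤s; s≤s⁻¹)
import Data.Nat.Properties as ℕ
open import Data.Nat.Properties using (+-*-semiring)
open import Data.Nat.Induction using (<-rec)
open import Data.Nat.Tactic.RingSolver using (solve-∀)
open import Data.Product.Base using (∃-syntax; _×_; _,_; proj₁; proj₂)
open import Data.Sum.Base as Sum using (_⊎_; inj₁; inj₂; [_,_]′)
open import Data.Vec.Base as Vec using ([]; _∷_)
open import Data.Vec.Properties using (lookup∘tabulate; lookup⇒[]=; []=⇒lookup)
open import Function.Base using (_∘_; id; case_of_)
open import Function.Bundles using (_⇔_; mk⇔; Equivalence)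
open import Relation.Binary.Construct.Closure.ReflexiveTransitive using (Star; ε; _◅_; _◅◅_)
open import Relation.Binary.Definitions using (Decidable; DecidableEquality)
open import Relation.Binary.PropositionalEquality using (_≡_; _≢_; refl; sym; trans; cong; cong₂; subst; subst₂; setoid; module ≡-Reasoning)
open import Relation.Nullary.Decidable using (Dec; yes; no; does; ¬?; _×-dec_; _⊎-dec_; _→-dec_; map′)
open import Relation.Nullary.Negation.Core using (¬_; contradiction)
import Relation.Unary as U
open import Algebra.Properties.Semiring.Sum +-*-semiring using (sum; sum-cong-≗; ∑-distrib-+; ∑-comm; *-distribˡ-sum)
open import Defs

-- Counting in finite sets

sum-mono : ∀ {n} {f g : Fin n → ℕ} → (∀ i → f i ≤ g i) → sum f ≤ sum g
sum-mono {zero}  h = z≤n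
sum-mono {suc n} h = ℕ.+-mono-≤ (h zero) (sum-mono (h ∘ suc))

sum-mono-< : ∀ {n} {f g : Fin n → ℕ} → (∀ i → f i ≤ g i) → ∀ j → f j < g j → sum f < sum g
sum-mono-< h zero    lt = ℕ.+-mono-<-≤ lt (sum-mono (h ∘ suc))
sum-mono-< h (suc j) lt = ℕ.+-mono-≤-< (h zero) (sum-mono-< (h ∘ suc) j lt)

sum-positive : ∀ {n} (f : Fin n → ℕ) → 0 < sum f → ∃[ i ] 0 < f i
sum-positive {suc n} f lt with f zero in eq
... | suc m = zero , subst (0 <_) (sym eq) (s≤s z≤n)
... | zero  with i , p ← sum-positive (f ∘ suc) lt = suc i , p

sum-zero : ∀ {n} {f : Fin n → ℕ} → (∀ i → f i ≡ 0) → sum f ≡ 0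
sum-zero {zero}  h = refl
sum-zero {suc n} h = cong₂ _+_ (h zero) (sum-zero (h ∘ suc))

-- The indicator of a decided proposition.
𝟙 : {P : Set} → Dec P → ℕ
𝟙 (yes _) = 1
𝟙 (no _)  = 0

𝟙-yes : {P : Set} (d : Dec P) → P → 𝟙 d ≡ 1
𝟙-yes (yes _) p = refl
𝟙-yes (no ¬p) p = contradiction p ¬p

𝟙-no : {P : Set} (d : Dec P) → ¬ P → 𝟙 d ≡ 0
𝟙-no (yes p) ¬p = contradiction p ¬p
𝟙-no (no _)  ¬p = refl

𝟙-mono : {P Q : Set} (d : Dec P) (e : Dec Q) → (P → Q) → 𝟙 d ≤ 𝟙 e
𝟙-mono (yes p) e h = ℕ.≤-reflexive (sym (𝟙-yes e (h p)))
𝟙-mono (no _)  e h = z≤n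

𝟙-positive : {P : Set} (d : Dec P) → 0 < 𝟙 d → P
𝟙-positive (yes p) _ = p

-- The number of elements of Fin n satisfying a decidable predicate.
count : ∀ {n} {P : Fin n → Set} → U.Decidable P → ℕ
count P? = sum (λ v → 𝟙 (P? v))

count-mono : ∀ {n} {P Q : Fin n → Set} (P? : U.Decidable P) (Q? : U.Decidable Q) →
             (∀ v → P v → Q v) → count P? ≤ count Q?
count-mono P? Q? h = sum-mono (λ v → 𝟙-mono (P? v) (Q? v) (h v))

count-cong : ∀ {n} {P Q : Fin n → Set} (P? : U.Decidable P) (Q? : U.Decidable Q) →
             (∀ v → P v → Q v) → (∀ v → Q v → P v) → count P? ≡ count Q?
count-cong P? Q? h k = ℕ.≤-antisym (count-mono P? Q? h) (count-mono Q? P? k)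

count-≡ : ∀ {n} (x : Fin n) → count (_≟ x) ≡ 1
count-≡ {suc n} zero = cong suc (sum-zero {n} (λ i → 𝟙-no (suc i ≟ zero) λ ()))
count-≡ (suc x) = trans (count-cong (λ v → suc v ≟ suc x) (_≟ x)
  (λ { v refl → refl }) (λ { v refl → refl })) (count-≡ x)

count-⊎ : ∀ {n} {P Q R : Fin n → Set}
          (P? : U.Decidable P) (Q? : U.Decidable Q) (R? : U.Decidable R) →
          (∀ v → P v → ¬ Q v) → (∀ v → P v ⊎ Q v → R v) → count P? + count Q? ≤ count R?
count-⊎ P? Q? R? disj incl =
  ℕ.≤-trans (ℕ.≤-reflexive (sym (∑-distrib-+ (𝟙 ∘ P?) (𝟙 ∘ Q?)))) (sum-mono pointwise)
  where
  pointwise : ∀ v → 𝟙 (P? v) + 𝟙 (Q? v) ≤ 𝟙 (R? v)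
  pointwise v with P? v | Q? v
  ... | yes p | yes q = contradiction q (disj v p)
  ... | yes p | no _  = ℕ.≤-reflexive (sym (𝟙-yes (R? v) (incl v (inj₁ p))))
  ... | no _  | yes q = ℕ.≤-reflexive (sym (𝟙-yes (R? v) (incl v (inj₂ q))))
  ... | no _  | no _  = z≤n

count-remove : ∀ {n} {P : Fin n → Set} (P? : U.Decidable P) (x : Fin n) → P x →
               count P? ≡ suc (count (λ v → P? v ×-dec ¬? (v ≟ x)))
count-remove P? x px = begin
  count P?                          ≡⟨ sum-cong-≗ pointwise ⟩
  sum (λ v → 𝟙 (v ≟ x) + 𝟙 (P⁻ v))  ≡⟨ ∑-distrib-+ (λ v → 𝟙 (v ≟ x)) (𝟙 ∘ P⁻) ⟩
  count (_≟ x) + count P⁻           ≡⟨ cong (_+ count P⁻) (count-≡ x) ⟩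
  suc (count P⁻)                    ∎
  where
  open ≡-Reasoning
  P⁻ = λ v → P? v ×-dec ¬? (v ≟ x)
  pointwise : ∀ v → 𝟙 (P? v) ≡ 𝟙 (v ≟ x) + 𝟙 (P⁻ v)
  pointwise v with P? v | v ≟ x
  ... | yes p | yes _    = refl
  ... | yes p | no _     = refl
  ... | no ¬p | yes refl = contradiction px ¬p
  ... | no ¬p | no _     = refl

count-positive : ∀ {n} {P : Fin n → Set} (P? : U.Decidable P) → 0 < count P? → ∃[ x ] P x
count-positive P? lt with x , p ← sum-positive (𝟙 ∘ P?) lt = x , 𝟙-positive (P? x) p

positive-count : ∀ {n} {P : Fin n → Set} (P? : U.Decidable P) x → P x → 0 < count P?
positive-count P? x px = subst (0 <_) (sym (count-remove P? x px)) (s≤s z≤n)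

count-none : ∀ {n} {P : Fin n → Set} (P? : U.Decidable P) → (∀ x → ¬ P x) → count P? ≡ 0
count-none P? h = sum-zero (λ v → 𝟙-no (P? v) (h v))

two-count : ∀ {n} {P : Fin n → Set} (P? : U.Decidable P) x y → P x → P y → x ≢ y → 1 < count P?
two-count P? x y px py x≢y = subst (1 <_) (sym (count-remove P? x px))
  (s≤s (positive-count (λ v → P? v ×-dec ¬? (v ≟ x)) y (py , x≢y ∘ sym)))

unique-∉ : {A : Set} {x : A} {xs : List A} → Unique (x ∷ xs) → x ∉ₗ xs
unique-∉ (x≢ ∷ _) x∈ = All.lookup x≢ x∈ refl

count-enumerated : ∀ {n} {P : Fin n → Set} (P? : U.Decidable P) (xs : List (Fin n)) → Unique xs →
                   (∀ v → P v → v ∈ₗ xs) → (∀ v → v ∈ₗ xs → P v) → count P? ≡ length xs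
count-enumerated P? [] u h k = count-none P? (λ v p → case h v p of λ ())
count-enumerated {P = P} P? (x ∷ xs) u@(_ ∷ u′) h k =
  trans (count-remove P? x (k x (here refl)))
        (cong suc (count-enumerated (λ v → P? v ×-dec ¬? (v ≟ x)) xs u′ h′ k′))
  where
  h′ : ∀ v → P v × v ≢ x → v ∈ₗ xs
  h′ v (p , v≢x) with h v p
  ... | here v≡x = contradiction v≡x v≢x
  ... | there v∈ = v∈
  k′ : ∀ v → v ∈ₗ xs → P v × v ≢ x
  k′ v v∈ = k v (there v∈) , λ { refl → unique-∉ u v∈ }

count-cover : ∀ {n} {P Q : Fin n → Set} (P? : U.Decidable P) (Q? : U.Decidable Q) a →
              (∀ v → P v → Q v ⊎ v ≡ a) → count P? ≤ suc (count Q?)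
count-cover P? Q? a h = ℕ.≤-trans (sum-mono pointwise)
  (ℕ.≤-reflexive (trans (∑-distrib-+ (λ v → 𝟙 (v ≟ a)) (𝟙 ∘ Q?)) (cong (_+ count Q?) (count-≡ a))))
  where
  pointwise : ∀ v → 𝟙 (P? v) ≤ 𝟙 (v ≟ a) + 𝟙 (Q? v)
  pointwise v with P? v
  ... | no _ = z≤n
  ... | yes p with h v p
  ...   | inj₁ q = ℕ.≤-trans (ℕ.≤-reflexive (sym (𝟙-yes (Q? v) q))) (ℕ.m≤n+m _ _)
  ...   | inj₂ e = ℕ.≤-trans (ℕ.≤-reflexive (sym (𝟙-yes (v ≟ a) e))) (ℕ.m≤m+n _ _)

length-filter-tabulate : ∀ {m} {A : Set} {P : A → Set} (P? : U.Decidable P) (f : Fin m → A) →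
                         length (filter P? (tabulate f)) ≡ sum (λ i → 𝟙 (P? (f i)))
length-filter-tabulate {zero}  P? f = refl
length-filter-tabulate {suc m} P? f with P? (f zero)
... | yes _ = cong suc (length-filter-tabulate P? (f ∘ suc))
... | no _  = length-filter-tabulate P? (f ∘ suc)

count-subset : ∀ {n} {P : Fin n → Set} (P? : U.Decidable P) →
               ∣ Vec.tabulate (λ v → does (P? v)) ∣ ≡ count P?
count-subset {zero}  P? = refl
count-subset {suc n} P? with P? zero
... | yes _ = cong suc (count-subset (P? ∘ suc))
... | no _  = count-subset (P? ∘ suc)

∈-subset : ∀ {n} {P : Fin n → Set} (P? : U.Decidable P) v →
           v ∈ Vec.tabulate (λ v → does (P? v)) ⇔ P v
∈-subset P? v = mk⇔ to from
  where
  to : _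
  to v∈ with P? v | trans (sym (lookup∘tabulate (does ∘ P?) v)) ([]=⇒lookup v∈)
  ... | yes p | _  = p
  ... | no _  | ()
  from : _
  from p with P? v in eq
  ... | yes _ = lookup⇒[]= v _ (trans (lookup∘tabulate (does ∘ P?) v) (cong does eq))
  ... | no ¬p = contradiction p ¬p

-- Multisets given by lists

multiset-∷ : ∀ {n} (x : Fin n) xs v → multiset (x ∷ xs) v ≡ 𝟙 (v ≟ x) + multiset xs v
multiset-∷ x xs v with v ≟ x
... | yes _ = refl
... | no _  = refl

size-multiset : ∀ {n} (xs : List (Fin n)) → ∣ multiset xs ∣ₘ ≡ length xs
size-multiset {n} [] = sum-zero {n} {multiset []} (λ _ → refl)
size-multiset (x ∷ xs) = begin
  ∣ multiset (x ∷ xs) ∣ₘ                     ≡⟨ sum-cong-≗ (multiset-∷ x xs) ⟩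
  sum (λ v → 𝟙 (v ≟ x) + multiset xs v)      ≡⟨ ∑-distrib-+ (λ v → 𝟙 (v ≟ x)) (multiset xs) ⟩
  count (_≟ x) + ∣ multiset xs ∣ₘ            ≡⟨ cong₂ _+_ (count-≡ x) (size-multiset xs) ⟩
  suc (length xs)                            ∎
  where open ≡-Reasoning

multiset-∈ : ∀ {n} (xs : List (Fin n)) {v} → v ∈ₘ multiset xs → v ∈ₗ xs
multiset-∈ (x ∷ xs) {v} lt with v ≟ x
... | yes refl = here refl
... | no _     = there (multiset-∈ xs lt)

∈-multiset : ∀ {n} (xs : List (Fin n)) {v} → v ∈ₗ xs → v ∈ₘ multiset xs
∈-multiset (x ∷ xs) {v} v∈ with v ≟ x | v∈
... | yes _  | _         = s≤s z≤n
... | no v≢x | here v≡x  = contradiction v≡x v≢x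
... | no _   | there v∈′ = ∈-multiset xs v∈′

multiset-∉ : ∀ {n} (xs : List (Fin n)) {v} → v ∉ₗ xs → multiset xs v ≡ 0
multiset-∉ xs {v} v∉ with multiset xs v in eq
... | zero  = refl
... | suc m = contradiction (multiset-∈ xs (subst (0 <_) (sym eq) (s≤s z≤n))) v∉

multiset-++ : ∀ {n} (xs ys : List (Fin n)) v → multiset (xs ++ ys) v ≡ multiset xs v + multiset ys v
multiset-++ []       ys v = refl
multiset-++ (x ∷ xs) ys v with v ≟ x
... | yes _ = cong suc (multiset-++ xs ys v)
... | no _  = multiset-++ xs ys v

multiset-↭ : ∀ {n} {xs ys : List (Fin n)} → xs ↭ ys → ∀ v → multiset xs v ≡ multiset ys v
multiset-↭ p v = ↭-length (Perm.filter-↭ (v ≟_) p)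

-- Consecutive elements of a list

-- The unordered pairs xy and ab are equal.
Pair : {A : Set} (x y a b : A) → Set
Pair x y a b = (x ≡ a × y ≡ b) ⊎ (x ≡ b × y ≡ a)

Pair-swap : {A : Set} {x y a b : A} → Pair x y a b → Pair x y b a
Pair-swap = Sum.swap

-- x and y are consecutive in a list, in either order.
data Nbr {A : Set} : List A → A → A → Set where
  fwd  : ∀ {a b l} → Nbr (a ∷ b ∷ l) a b
  bwd  : ∀ {a b l} → Nbr (a ∷ b ∷ l) b a
  skip : ∀ {a l x y} → Nbr l x y → Nbr (a ∷ l) x y

module _ {A : Set} where

  Nbr-sym : ∀ {l : List A} {x y} → Nbr l x y → Nbr l y x
  Nbr-sym fwd      = bwd
  Nbr-sym bwd      = fwd
  Nbr-sym (skip p) = skip (Nbr-sym p)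

  Nbr-∈ : ∀ {l : List A} {x y} → Nbr l x y → x ∈ₗ l
  Nbr-∈ fwd      = here refl
  Nbr-∈ bwd      = there (here refl)
  Nbr-∈ (skip p) = there (Nbr-∈ p)

  Nbr-++ˡ : ∀ {xs} ys {x y : A} → Nbr xs x y → Nbr (xs ++ ys) x y
  Nbr-++ˡ ys fwd      = fwd
  Nbr-++ˡ ys bwd      = bwd
  Nbr-++ˡ ys (skip p) = skip (Nbr-++ˡ ys p)

  Nbr-++ʳ : ∀ xs {ys} {x y : A} → Nbr ys x y → Nbr (xs ++ ys) x y
  Nbr-++ʳ []       p = p
  Nbr-++ʳ (_ ∷ xs) p = skip (Nbr-++ʳ xs p)

  Nbr-split : ∀ xs {a b ys} {x y : A} → Nbr (xs ++ a ∷ b ∷ ys) x y →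
              Nbr (xs ++ a ∷ []) x y ⊎ Pair x y a b ⊎ Nbr (b ∷ ys) x y
  Nbr-split []           fwd      = inj₂ (inj₁ (inj₁ (refl , refl)))
  Nbr-split []           bwd      = inj₂ (inj₁ (inj₂ (refl , refl)))
  Nbr-split []           (skip p) = inj₂ (inj₂ p)
  Nbr-split (_ ∷ [])     fwd      = inj₁ fwd
  Nbr-split (_ ∷ [])     bwd      = inj₁ bwd
  Nbr-split (_ ∷ _ ∷ xs) fwd      = inj₁ fwd
  Nbr-split (_ ∷ _ ∷ xs) bwd      = inj₁ bwd
  Nbr-split (_ ∷ xs)     (skip p) = Sum.map₁ skip (Nbr-split xs p)

  Nbr-unsplit : ∀ xs {a b ys} {x y : A} →
                Nbr (xs ++ a ∷ []) x y ⊎ Pair x y a b ⊎ Nbr (b ∷ ys) x y →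
                Nbr (xs ++ a ∷ b ∷ ys) x y
  Nbr-unsplit xs {a} {b} {ys} {x} {y} (inj₁ p) =
    subst (λ l → Nbr l x y) (++-assoc xs (a ∷ []) (b ∷ ys)) (Nbr-++ˡ (b ∷ ys) p)
  Nbr-unsplit xs (inj₂ (inj₁ (inj₁ (refl , refl)))) = Nbr-++ʳ xs fwd
  Nbr-unsplit xs (inj₂ (inj₁ (inj₂ (refl , refl)))) = Nbr-++ʳ xs bwd
  Nbr-unsplit xs (inj₂ (inj₂ p)) = Nbr-++ʳ xs (skip p)

  Nbr-reverse : ∀ {l : List A} {x y} → Nbr l x y → Nbr (reverse l) x y
  Nbr-reverse {a ∷ b ∷ l} fwd =
    subst (λ l′ → Nbr l′ a b) (sym (reverse-++ (a ∷ b ∷ []) l)) (Nbr-++ʳ (reverse l) bwd)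
  Nbr-reverse {a ∷ b ∷ l} bwd =
    subst (λ l′ → Nbr l′ b a) (sym (reverse-++ (a ∷ b ∷ []) l)) (Nbr-++ʳ (reverse l) fwd)
  Nbr-reverse {a ∷ l} {x} {y} (skip p) =
    subst (λ l′ → Nbr l′ x y) (sym (unfold-reverse a l)) (Nbr-++ˡ (a ∷ []) (Nbr-reverse p))

  Nbr-unreverse : ∀ {l : List A} {x y} → Nbr (reverse l) x y → Nbr l x y
  Nbr-unreverse {l} {x} {y} p = subst (λ l′ → Nbr l′ x y) (reverse-involutive l) (Nbr-reverse p)

  Nbr-find : ∀ {l : List A} {x y} → Nbr l x y →
             (∃[ xs ] ∃[ ys ] xs ++ x ∷ y ∷ ys ≡ l) ⊎ (∃[ xs ] ∃[ ys ] xs ++ y ∷ x ∷ ys ≡ l)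
  Nbr-find fwd = inj₁ ([] , _ , refl)
  Nbr-find bwd = inj₂ ([] , _ , refl)
  Nbr-find (skip {a} p) with Nbr-find p
  ... | inj₁ (xs , ys , eq) = inj₁ (a ∷ xs , ys , cong (a ∷_) eq)
  ... | inj₂ (xs , ys , eq) = inj₂ (a ∷ xs , ys , cong (a ∷_) eq)

  Nbr-first : ∀ {x y : A} {l} → x ∉ₗ l → Nbr (x ∷ l) x y → ∃[ l′ ] l ≡ y ∷ l′
  Nbr-first x∉ fwd      = _ , refl
  Nbr-first x∉ bwd      = contradiction (here refl) x∉
  Nbr-first x∉ (skip p) = contradiction (Nbr-∈ p) x∉

  Nbr-singleton : ∀ {a x y : A} → ¬ Nbr (a ∷ []) x y
  Nbr-singleton (skip ())

  linked⇒Nbr : ∀ {R : A → A → Set} → (∀ {x y} → R x y → R y x) →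
               ∀ {l} → Linked R l → ∀ {x y} → Nbr l x y → R x y
  linked⇒Nbr s (r ∷ rs) fwd      = r
  linked⇒Nbr s (r ∷ rs) bwd      = s r
  linked⇒Nbr s (r ∷ rs) (skip p) = linked⇒Nbr s rs p
  linked⇒Nbr s [-] (skip ())

  Nbr⇒linked : ∀ {R : A → A → Set} l → (∀ {x y} → Nbr l x y → R x y) → Linked R l
  Nbr⇒linked []          h = []
  Nbr⇒linked (a ∷ [])    h = [-]
  Nbr⇒linked (a ∷ b ∷ l) h = h fwd ∷ Nbr⇒linked (b ∷ l) (h ∘ skip)

  -- Lists without repetitions, and collections of paths

  unique-++ˡ : ∀ {xs ys : List A} → Unique (xs ++ ys) → Unique xs
  unique-++ˡ {[]}     u        = []
  unique-++ˡ {x ∷ xs} (x≢ ∷ u) = All.tabulate (λ i → All.lookup x≢ (∈-++⁺ˡ i)) ∷ unique-++ˡ u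

  unique-++ʳ : ∀ xs {ys : List A} → Unique (xs ++ ys) → Unique ys
  unique-++ʳ []       u       = u
  unique-++ʳ (_ ∷ xs) (_ ∷ u) = unique-++ʳ xs u

  unique-disjoint : ∀ xs {ys : List A} → Unique (xs ++ ys) → ∀ {x} → x ∈ₗ xs → x ∉ₗ ys
  unique-disjoint (x ∷ xs) (x≢ ∷ _) (here refl) x∈ys = All.lookup x≢ (∈-++⁺ʳ xs x∈ys) refl
  unique-disjoint (_ ∷ xs) (_ ∷ u)  (there x∈)  x∈ys = unique-disjoint xs u x∈ x∈ys

  unique-order : ∀ xs as {w u : A} {ys bs l} → Unique l → l ≡ xs ++ w ∷ u ∷ ys → l ≡ as ++ u ∷ w ∷ bs → ⊥
  unique-order [] [] un refl refl = unique-∉ un (here refl)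
  unique-order [] (a ∷ as) un refl e with refl ← ∷-injectiveˡ e =
    unique-∉ un (subst (_ ∈ₗ_) (sym (∷-injectiveʳ e)) (∈-++⁺ʳ as (there (here refl))))
  unique-order (x ∷ xs) [] un refl e with refl ← ∷-injectiveˡ e =
    unique-∉ un (∈-++⁺ʳ xs (there (here refl)))
  unique-order (x ∷ xs) (a ∷ as) (_ ∷ un) refl e = unique-order xs as un refl (∷-injectiveʳ e)

  unique-↭ : ∀ {xs ys : List A} → xs ↭ ys → Unique xs → Unique ys
  unique-↭ p = Unique-resp-↭ (setoid A) (↭⇒↭ₛ p)

-- Lists without repetitions, and collections of paths

  extract : ∀ {x : A} {xs} → x ∈ₗ xs → ∃[ rest ] xs ↭ x ∷ rest
  extract {x} x∈ with ys , zs , refl ← ∈-∃++ x∈ = ys ++ zs , Perm.shift x ys zs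

  extract₂ : ∀ {x y : A} {xs} → x ∈ₗ xs → y ∈ₗ xs → x ≢ y → ∃[ rest ] xs ↭ x ∷ y ∷ rest
  extract₂ {x} x∈ y∈ x≢y with rest , p ← extract x∈ with ∈-resp-↭ p y∈
  ... | here y≡x = contradiction (sym y≡x) x≢y
  ... | there y∈′ with rest′ , p′ ← extract y∈′ = rest′ , ↭-trans p (prep x p′)

  toList-++⁺ : ∀ xs (p : List⁺ A) → toList (xs ++⁺ p) ≡ xs ++ toList p
  toList-++⁺ []       p = refl
  toList-++⁺ (x ∷ xs) p = cong (x ∷_) (toList-++⁺ xs p)

  last-snoc : ∀ (p : List⁺ A) xs {x} → toList p ≡ xs ++ x ∷ [] → last p ≡ x
  last-snoc p xs eq with snocView p
  ... | []       ∷ʳ′ y = ∷ʳ-injectiveʳ [] xs eq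
  ... | (z ∷ ys) ∷ʳ′ y = ∷ʳ-injectiveʳ (z ∷ ys) xs eq

  toList-last : ∀ (p : List⁺ A) → ∃[ xs ] toList p ≡ xs ++ last p ∷ []
  toList-last p with snocView p
  ... | []       ∷ʳ′ y = [] , refl
  ... | (z ∷ ys) ∷ʳ′ y = z ∷ ys , refl

  unsnoc : (l : List A) → l ≡ [] ⊎ ∃[ xs ] ∃[ x ] l ≡ xs ++ x ∷ []
  unsnoc []      = inj₁ refl
  unsnoc (x ∷ l) with unsnoc l
  ... | inj₁ refl            = inj₂ ([] , x , refl)
  ... | inj₂ (xs , y , refl) = inj₂ (x ∷ xs , y , refl)

  -- The vertices on a collection of paths.
  vertices : List (List⁺ A) → List A
  vertices ps = concat (map toList ps)

  -- x and y are consecutive on one of the paths.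
  NbrIn : List (List⁺ A) → A → A → Set
  NbrIn ps x y = Any (λ p → Nbr (toList p) x y) ps

  NbrIn-∈ : ∀ {ps x y} → NbrIn ps x y → x ∈ₗ vertices ps
  NbrIn-∈ {p ∷ ps} (here i)  = ∈-++⁺ˡ (Nbr-∈ i)
  NbrIn-∈ {p ∷ ps} (there i) = ∈-++⁺ʳ (toList p) (NbrIn-∈ i)

  NbrIn-sym : ∀ {ps x y} → NbrIn ps x y → NbrIn ps y x
  NbrIn-sym = Any.map Nbr-sym

  ∈-vertices : ∀ {ps p x} → p ∈ₗ ps → x ∈ₗ toList p → x ∈ₗ vertices ps
  ∈-vertices p∈ x∈ = ∈-concat⁺′ x∈ (∈-map⁺ toList p∈)

  vertices-∈ : ∀ ps {x} → x ∈ₗ vertices ps → ∃[ p ] p ∈ₗ ps × x ∈ₗ toList p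
  vertices-∈ ps x∈ with l , x∈l , l∈ ← ∈-concat⁻′ (map toList ps) x∈
                   with p , p∈ , refl ← ∈-map⁻ toList l∈ = p , p∈ , x∈l

  concatMap-↭ : ∀ {B : Set} (f : B → List A) {ps qs} → ps ↭ qs → concatMap f ps ↭ concatMap f qs
  concatMap-↭ f _↭_.refl = ↭-refl
  concatMap-↭ f (_↭_.prep p r) = Perm.++⁺ˡ (f p) (concatMap-↭ f r)
  concatMap-↭ f (_↭_.swap p q r) =
    ↭-trans (Perm.shifts (f p) (f q)) (Perm.++⁺ˡ (f q) (Perm.++⁺ˡ (f p) (concatMap-↭ f r)))
  concatMap-↭ f (_↭_.trans r s) = ↭-trans (concatMap-↭ f r) (concatMap-↭ f s)

  vertices-↭ : ∀ {ps qs} → ps ↭ qs → vertices ps ↭ vertices qs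
  vertices-↭ = concatMap-↭ toList

  -- q lists the path p in one of its two directions.
  Reading : List⁺ A → List A → Set
  Reading p q = q ≡ toList p ⊎ q ≡ reverse (toList p)

  reading-↭ : ∀ {p q} → Reading p q → q ↭ toList p
  reading-↭ (inj₁ refl) = ↭-refl
  reading-↭ {p} (inj₂ refl) = ↭-reverse (toList p)

  reading-Nbr : ∀ {p q} → Reading p q → ∀ {x y} → Nbr q x y → Nbr (toList p) x y
  reading-Nbr (inj₁ refl) i = i
  reading-Nbr (inj₂ refl) i = Nbr-unreverse i

  Nbr-reading : ∀ {p q} → Reading p q → ∀ {x y} → Nbr (toList p) x y → Nbr q x y
  Nbr-reading (inj₁ refl) i = i
  Nbr-reading (inj₂ refl) i = Nbr-reverse i

_∈?_ : ∀ {n} (x : Fin n) l → Dec (x ∈ₗ l)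
x ∈? l = Any.any? (x ≟_) l

-- Edges, endpoints and degrees in a linear forest

Nbr? : ∀ {n} (l : List (Fin n)) x y → Dec (Nbr l x y)
Nbr? []          x y = no λ ()
Nbr? (a ∷ [])    x y = no Nbr-singleton
Nbr? (a ∷ b ∷ l) x y =
  map′ to from ((((x ≟ a) ×-dec (y ≟ b)) ⊎-dec ((x ≟ b) ×-dec (y ≟ a))) ⊎-dec Nbr? (b ∷ l) x y)
  where
  to : Pair x y a b ⊎ Nbr (b ∷ l) x y → Nbr (a ∷ b ∷ l) x y
  to p = Nbr-unsplit [] (inj₂ p)
  from : Nbr (a ∷ b ∷ l) x y → Pair x y a b ⊎ Nbr (b ∷ l) x y
  from fwd      = inj₁ (inj₁ (refl , refl))
  from bwd      = inj₁ (inj₂ (refl , refl))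
  from (skip p) = inj₂ p

last-∈ʳ : ∀ {A : Set} (p : List⁺ A) as {b bs} → toList p ≡ as ++ b ∷ bs → last p ∈ₗ b ∷ bs
last-∈ʳ p as {b} {bs} eq with unsnoc (b ∷ bs)
... | inj₂ (zs , l , e) = subst₂ _∈ₗ_ (sym l≡) (sym e) (∈-++⁺ʳ zs (here refl))
  where
  l≡ : last p ≡ l
  l≡ = last-snoc p (as ++ zs) (trans eq (trans (cong (as ++_) e) (sym (++-assoc as zs (l ∷ [])))))

multiset-two : ∀ {n} (a b x : Fin n) → multiset (a ∷ b ∷ []) x ≡ 𝟙 (x ≟ a) + 𝟙 (x ≟ b)
multiset-two a b x = trans (multiset-∷ a (b ∷ []) x)
  (cong (𝟙 (x ≟ a) +_) (trans (multiset-∷ b [] x) (ℕ.+-identityʳ _)))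

-- The neighbours of x on a path, listed, together with the number of times
-- that x is an end of that path.
PathDegree : ∀ {n} → List⁺ (Fin n) → Fin n → Set
PathDegree p x = ∃[ L ] Unique L × (∀ y → Nbr (toList p) x y → y ∈ₗ L) × (∀ y → y ∈ₗ L → Nbr (toList p) x y)
                   × multiset (head p ∷ last p ∷ []) x + length L ≡ 2

path-degree : ∀ {n} (p : List⁺ (Fin n)) as {x} bs → toList p ≡ as ++ x ∷ bs → Unique (toList p) → PathDegree p x
path-degree {n} p@(h ∷ t) as {x} bs eq u with unsnoc as
... | inj₁ refl = first bs eq u
  where
  first : ∀ bs → toList p ≡ x ∷ bs → Unique (toList p) → PathDegree p x
  first [] refl _ = [] , [] , (λ y i → contradiction i Nbr-singleton) , (λ _ ()) ,
    trans (ℕ.+-identityʳ _) (trans (multiset-two h h h) (cong₂ _+_ (𝟙-yes (h ≟ h) refl) (𝟙-yes (h ≟ h) refl)))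
  first (b ∷ bs′) refl u = b ∷ [] , [] ∷ [] , to , (λ { y (here refl) → fwd }) ,
    cong (_+ 1) (trans (multiset-two h (last p) h) (cong₂ _+_ (𝟙-yes (h ≟ h) refl) (𝟙-no (h ≟ last p) h≢last)))
    where
    to : ∀ y → Nbr (toList p) h y → y ∈ₗ b ∷ []
    to y i with _ , refl ← Nbr-first (unique-∉ u) i = here refl
    h≢last : h ≢ last p
    h≢last e = unique-∉ u (subst (_∈ₗ b ∷ bs′) (sym e) (last-∈ʳ p (h ∷ []) refl))
... | inj₂ (as′ , a , refl) = inner bs refl
  where
  u′ : Unique ((as′ ++ a ∷ []) ++ x ∷ bs)
  u′ = subst Unique eq u
  disj : ∀ {y} → y ∈ₗ as′ ++ a ∷ [] → y ∉ₗ x ∷ bs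
  disj = unique-disjoint (as′ ++ a ∷ []) u′
  x∉bs : x ∉ₗ bs
  x∉bs = unique-∉ (unique-++ʳ (as′ ++ a ∷ []) u′)
  eq′ : toList p ≡ as′ ++ a ∷ x ∷ bs
  eq′ = trans eq (++-assoc as′ (a ∷ []) (x ∷ bs))
  a∈ : a ∈ₗ as′ ++ a ∷ []
  a∈ = ∈-++⁺ʳ as′ (here refl)
  x∉as : x ∉ₗ as′ ++ a ∷ []
  x∉as x∈ = disj x∈ (here refl)
  h∈ : ∀ as″ {c} → h ∷ t ≡ (as″ ++ a ∷ []) ++ c → h ∈ₗ as″ ++ a ∷ []
  h∈ []       e = here (∷-injectiveˡ e)
  h∈ (_ ∷ as) e = here (∷-injectiveˡ e)
  x≢h : x ≢ h
  x≢h e = x∉as (subst (_∈ₗ as′ ++ a ∷ []) (sym e) (h∈ as′ eq))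
  split : ∀ y → Nbr (toList p) x y → y ≡ a ⊎ Nbr (x ∷ bs) x y
  split y i with Nbr-split as′ (subst (λ l → Nbr l x y) eq′ i)
  ... | inj₁ j                        = contradiction (Nbr-∈ j) x∉as
  ... | inj₂ (inj₁ (inj₁ (refl , _))) = contradiction a∈ x∉as
  ... | inj₂ (inj₁ (inj₂ (_ , y≡a)))  = inj₁ y≡a
  ... | inj₂ (inj₂ j)                 = inj₂ j
  nbr-a : Nbr (toList p) x a
  nbr-a = subst (λ l → Nbr l x a) (sym eq′) (Nbr-++ʳ as′ bwd)
  inner : ∀ cs → bs ≡ cs → PathDegree p x
  inner [] bs≡ = a ∷ [] , [] ∷ [] , to , (λ { y (here refl) → nbr-a }) ,
    cong (_+ 1) (trans (multiset-two h (last p) x) (cong₂ _+_ (𝟙-no (x ≟ h) x≢h)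
      (𝟙-yes (x ≟ last p) (sym (last-snoc p (as′ ++ a ∷ []) (trans eq (cong (λ l → (as′ ++ a ∷ []) ++ x ∷ l) bs≡)))))))
    where
    to : ∀ y → Nbr (toList p) x y → y ∈ₗ a ∷ []
    to y i with split y i
    ... | inj₁ y≡a = here y≡a
    ... | inj₂ j   = contradiction (subst (λ l → Nbr (x ∷ l) x y) bs≡ j) Nbr-singleton
  inner (b ∷ bs′) bs≡ = a ∷ b ∷ [] , ((a≢b ∷ []) ∷ [] ∷ []) , to , from ,
    cong (_+ 2) (trans (multiset-two h (last p) x) (cong₂ _+_ (𝟙-no (x ≟ h) x≢h) (𝟙-no (x ≟ last p) x≢last)))
    where
    a≢b : a ≢ b
    a≢b a≡b = disj a∈ (there (subst (a ∈ₗ_) (sym bs≡) (here a≡b)))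
    to : ∀ y → Nbr (toList p) x y → y ∈ₗ a ∷ b ∷ []
    to y i with split y i
    ... | inj₁ y≡a = here y≡a
    ... | inj₂ j with _ , e′ ← Nbr-first x∉bs j = there (here (∷-injectiveˡ (trans (sym e′) bs≡)))
    from : ∀ y → y ∈ₗ a ∷ b ∷ [] → Nbr (toList p) x y
    from y (here refl)         = nbr-a
    from y (there (here refl)) = subst (λ l → Nbr l x b)
      (sym (trans eq (cong (λ l → (as′ ++ a ∷ []) ++ x ∷ l) bs≡))) (Nbr-++ʳ (as′ ++ a ∷ []) fwd)
    x≢last : x ≢ last p
    x≢last e = x∉bs (subst₂ _∈ₗ_ (sym e) (sym bs≡)
      (last-∈ʳ p (as′ ++ a ∷ x ∷ []) (trans eq′ (trans (cong (λ l → as′ ++ a ∷ x ∷ l) bs≡)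
                                                   (sym (++-assoc as′ (a ∷ x ∷ []) (b ∷ bs′)))))))

-- Both ends of every path, so that End F is the multiset of this list.
endpoints : ∀ {n} → List (List⁺ (Fin n)) → List (Fin n)
endpoints = concatMap (λ p → head p ∷ last p ∷ [])

endpoints-∈ : ∀ {n} ps {v : Fin n} → v ∈ₗ endpoints ps → ∃[ p ] p ∈ₗ ps × (v ≡ head p ⊎ v ≡ last p)
endpoints-∈ (p ∷ ps) (here v≡)           = p , here refl , inj₁ v≡
endpoints-∈ (p ∷ ps) (there (here v≡))   = p , here refl , inj₂ v≡
endpoints-∈ (p ∷ ps) (there (there v∈)) with q , q∈ , e ← endpoints-∈ ps v∈ = q , there q∈ , e

last-∈ : ∀ {A : Set} (p : List⁺ A) → last p ∈ₗ toList p
last-∈ p with xs , eq ← toList-last p = subst (last p ∈ₗ_) (sym eq) (∈-++⁺ʳ xs (here refl))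

endpoints⊆vertices : ∀ {n} ps {v : Fin n} → v ∈ₗ endpoints ps → v ∈ₗ vertices ps
endpoints⊆vertices ps v∈ with endpoints-∈ ps v∈
... | p , p∈ , inj₁ refl = ∈-vertices p∈ (here refl)
... | p , p∈ , inj₂ refl = ∈-vertices p∈ (last-∈ p)

length-endpoints : ∀ {n} (ps : List (List⁺ (Fin n))) → length (endpoints ps) ≡ 2 * length ps
length-endpoints []       = refl
length-endpoints (p ∷ ps) = trans (cong (2 +_) (length-endpoints ps)) (sym (ℕ.*-suc 2 (length ps)))

module _ {n : ℕ} {G : Graph n} (F : LinearForest G) where
  open Graph G
  open LinearForest F

  size-End : ∣ End F ∣ₘ ≡ 2 * #paths F
  size-End = trans (size-multiset (endpoints paths)) (length-endpoints paths)

  Edge⇒NbrIn : ∀ {x y} → Edge F x y → NbrIn paths x y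
  Edge⇒NbrIn (xs , ys , p , p∈ , r) =
    Any.map (λ { refl → reading-Nbr r (Nbr-++ʳ xs fwd) }) p∈

  NbrIn⇒Edge : ∀ {x y} → NbrIn paths x y → Edge F x y
  NbrIn⇒Edge {x} {y} i with p , p∈ , j ← find i with Nbr-find j
  ... | inj₁ (xs , ys , eq) = xs , ys , p , p∈ , inj₁ eq
  ... | inj₂ (xs , ys , eq) = reverse ys , reverse xs , p , p∈ , inj₂ (sym eq″)
    where
    eq″ : reverse (toList p) ≡ reverse ys ++ x ∷ y ∷ reverse xs
    eq″ = trans (cong reverse (sym eq)) (reverse-mid xs ys)
      where
      reverse-mid : ∀ xs ys → reverse (xs ++ y ∷ x ∷ ys) ≡ reverse ys ++ x ∷ y ∷ reverse xs
      reverse-mid xs ys = begin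
        reverse (xs ++ y ∷ x ∷ ys)                   ≡⟨ reverse-++ xs (y ∷ x ∷ ys) ⟩
        reverse (y ∷ x ∷ ys) ++ reverse xs           ≡⟨ cong (_++ reverse xs) (reverse-++ (y ∷ x ∷ []) ys) ⟩
        (reverse ys ++ x ∷ y ∷ []) ++ reverse xs     ≡⟨ ++-assoc (reverse ys) _ _ ⟩
        reverse ys ++ x ∷ y ∷ reverse xs             ∎
        where open ≡-Reasoning

  Edge-sym : ∀ {x y} → Edge F x y → Edge F y x
  Edge-sym = NbrIn⇒Edge ∘ NbrIn-sym ∘ Edge⇒NbrIn

  edge? : Decidable (Edge F)
  edge? x y = map′ NbrIn⇒Edge Edge⇒NbrIn (Any.any? (λ p → Nbr? (toList p) x y) paths)

  Edge⇒~ : ∀ {x y} → Edge F x y → x ~ y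
  Edge⇒~ e with p , p∈ , j ← find (Edge⇒NbrIn e) =
    linked⇒Nbr ~-sym (All.lookup inGraph p∈) j

  unique-path : ∀ {p} → p ∈ₗ paths → Unique (toList p)
  unique-path p∈ with rest , r ← extract p∈ =
    unique-++ˡ (unique-↭ (vertices-↭ r) disjoint)

  same-path : ∀ {p q x} → p ∈ₗ paths → q ∈ₗ paths → x ∈ₗ toList p → x ∈ₗ toList q → p ≡ q
  same-path {p} {q} p∈ q∈ x∈p x∈q with rest , r ← extract p∈ with ∈-resp-↭ r q∈
  ... | here q≡p  = sym q≡p
  ... | there q∈′ = contradiction (∈-vertices q∈′ x∈q)
                      (unique-disjoint (toList p) (unique-↭ (vertices-↭ r) disjoint) x∈p)

  Edge⇒Nbr : ∀ {p x y} → p ∈ₗ paths → x ∈ₗ toList p → Edge F x y → Nbr (toList p) x y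
  Edge⇒Nbr p∈ x∈ e with q , q∈ , j ← find (Edge⇒NbrIn e)
    with refl ← same-path p∈ q∈ x∈ (Nbr-∈ j) = j

  Nbr⇒Edge : ∀ {p x y} → p ∈ₗ paths → Nbr (toList p) x y → Edge F x y
  Nbr⇒Edge p∈ j = NbrIn⇒Edge (Any.map (λ { refl → j }) p∈)

  End-on-path : ∀ {p x} → p ∈ₗ paths → x ∈ₗ toList p → End F x ≡ multiset (head p ∷ last p ∷ []) x
  End-on-path {p} {x} p∈ x∈ with rest , r ← extract p∈ = begin
    multiset (endpoints paths) x                                  ≡⟨ multiset-↭ (concatMap-↭ _ r) x ⟩
    multiset (head p ∷ last p ∷ endpoints rest) x                 ≡⟨ multiset-++ (head p ∷ last p ∷ []) (endpoints rest) x ⟩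
    multiset (head p ∷ last p ∷ []) x + multiset (endpoints rest) x
      ≡⟨ cong (multiset (head p ∷ last p ∷ []) x +_) (multiset-∉ (endpoints rest) x∉) ⟩
    multiset (head p ∷ last p ∷ []) x + 0                         ≡⟨ ℕ.+-identityʳ _ ⟩
    multiset (head p ∷ last p ∷ []) x                             ∎
    where
    open ≡-Reasoning
    x∉ : x ∉ₗ endpoints rest
    x∉ x∈r = unique-disjoint (toList p) (unique-↭ (vertices-↭ r) disjoint) x∈ (endpoints⊆vertices rest x∈r)

  -- The degree of a vertex in the forest.
  degreeᶠ : Fin n → ℕ
  degreeᶠ x = count (edge? x)

  -- A vertex misses one of two neighbours for each time it is an end.
  End+degree : ∀ x → End F x + degreeᶠ x ≡ 2
  End+degree x with p , p∈ , x∈ ← vertices-∈ paths (spanning x) with as , bs , eq ← ∈-∃++ x∈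
    with L , uL , to , from , total ← path-degree p as bs eq (unique-path p∈) = begin
    End F x + degreeᶠ x                                ≡⟨ cong₂ _+_ (End-on-path p∈ x∈)
         (count-enumerated (edge? x) L uL (λ y e → to y (Edge⇒Nbr p∈ x∈ e)) (λ y y∈ → Nbr⇒Edge p∈ (from y y∈))) ⟩
    multiset (head p ∷ last p ∷ []) x + length L       ≡⟨ total ⟩
    2                                                  ∎
    where open ≡-Reasoning

  -- An endpoint is the first vertex of a reading of its path.
  end-reading : ∀ {v} → v ∈ₘ End F → ∃[ zs ] Traverses F (v ∷ zs)
  end-reading v∈ with endpoints-∈ paths (multiset-∈ (endpoints paths) v∈)
  ... | p , p∈ , inj₁ refl = List⁺.tail p , p , p∈ , inj₁ refl
  ... | p , p∈ , inj₂ refl with xs , eq ← toList-last p =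
    reverse xs , p , p∈ , inj₂ (sym (trans (cong reverse eq) (reverse-++ xs (last p ∷ []))))

-- Cutting and joining paths

module _ {n : ℕ} {G : Graph n} (F : LinearForest G) where
  open Graph G
  open LinearForest F

  -- Any arrangement of the vertices of F into paths along edges of G.
  rearrange : (ps : List (List⁺ (Fin n))) → vertices paths ↭ vertices ps →
              (∀ {x y} → NbrIn ps x y → x ~ y) → LinearForest G
  rearrange ps r adj = record
    { paths    = ps
    ; inGraph  = All.tabulate (λ {p} p∈ → Nbr⇒linked (toList p) (λ j → adj (Any.map (λ { refl → j }) p∈)))
    ; disjoint = unique-↭ r disjoint
    ; spanning = λ v → ∈-resp-↭ r (spanning v)
    }

  -- F consists of a path traversed as q and the paths of rest.
  record Split (q : List (Fin n)) (rest : List (List⁺ (Fin n))) : Set where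
    field
      #rest  : #paths F ≡ suc (length rest)
      verts  : vertices paths ↭ q ++ vertices rest
      edge⁻  : ∀ {x y} → Edge F x y → Nbr q x y ⊎ NbrIn rest x y
      edge⁺  : ∀ {x y} → Nbr q x y ⊎ NbrIn rest x y → Edge F x y

  split : ∀ {q} → Traverses F q → ∃[ rest ] Split q rest
  split {q} (p , p∈ , r) with rest , s ← extract p∈ = rest , record
    { #rest = ↭-length s
    ; verts = ↭-trans (vertices-↭ s) (Perm.++⁺ʳ (vertices rest) (↭-sym (reading-↭ r)))
    ; edge⁻ = λ e → case Any-resp-↭ s (Edge⇒NbrIn F e) of λ
        { (here j) → inj₁ (Nbr-reading r j) ; (there j) → inj₂ j }
    ; edge⁺ = λ { (inj₁ j) → NbrIn⇒Edge F (Any-resp-↭ (↭-sym s) (here (reading-Nbr r j)))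
                ; (inj₂ j) → NbrIn⇒Edge F (Any-resp-↭ (↭-sym s) (there j)) }
    }

  -- F consists of two paths traversed as q and q′ and the paths of rest.
  record Split₂ (q q′ : List (Fin n)) (rest : List (List⁺ (Fin n))) : Set where
    field
      #rest  : #paths F ≡ 2 + length rest
      verts  : vertices paths ↭ q ++ q′ ++ vertices rest
      edge⁻  : ∀ {x y} → Edge F x y → Nbr q x y ⊎ Nbr q′ x y ⊎ NbrIn rest x y
      edge⁺  : ∀ {x y} → Nbr q x y ⊎ Nbr q′ x y ⊎ NbrIn rest x y → Edge F x y

  apart⇒≢ : ∀ {q q′ u v p p′} → p ∈ₗ paths → Reading p q → Reading p′ q′ → v ∈ₗ q → u ∈ₗ q′ →
            ¬ SamePath F u v → p ≢ p′
  apart⇒≢ {p = p} p∈ r r′ v∈ u∈ apart refl =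
    apart (p , p∈ , ∈-resp-↭ (reading-↭ r′) u∈ , ∈-resp-↭ (reading-↭ r) v∈)

  split₂ : ∀ {q q′ u v} → Traverses F q → Traverses F q′ → v ∈ₗ q → u ∈ₗ q′ → ¬ SamePath F u v →
           ∃[ rest ] Split₂ q q′ rest
  split₂ {q} {q′} {u} {v} (p , p∈ , r) (p′ , p∈′ , r′) v∈ u∈ apart
    with rest , s ← extract₂ p∈ p∈′ (apart⇒≢ p∈ r r′ v∈ u∈ apart) = rest , record
    { #rest = ↭-length s
    ; verts = ↭-trans (vertices-↭ s) (Perm.++⁺ (↭-sym (reading-↭ r)) (Perm.++⁺ʳ (vertices rest) (↭-sym (reading-↭ r′))))
    ; edge⁻ = λ e → case Any-resp-↭ s (Edge⇒NbrIn F e) of λ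
        { (here j) → inj₁ (Nbr-reading r j)
        ; (there (here j)) → inj₂ (inj₁ (Nbr-reading r′ j))
        ; (there (there j)) → inj₂ (inj₂ j) }
    ; edge⁺ = λ { (inj₁ j) → back s (here (reading-Nbr r j))
                ; (inj₂ (inj₁ j)) → back s (there (here (reading-Nbr r′ j)))
                ; (inj₂ (inj₂ j)) → back s (there (there j)) }
    }
    where
    back : ∀ {qs} → paths ↭ qs → ∀ {x y} → NbrIn qs x y → Edge F x y
    back s j = NbrIn⇒Edge F (Any-resp-↭ (↭-sym s) j)

  -- The edge set of F′ is that of F with the edge uw replaced by uv.
  Rewired : (v u w : Fin n) → LinearForest G → Set
  Rewired v u w F′ = ∀ x y → Edge F′ x y ⇔ ((Edge F x y × ¬ Pair x y u w) ⊎ Pair x y u v)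

  -- Both edge sets arise from the same remainder K by adding one edge.
  rewired : ∀ {v u w F′} (K : Fin n → Fin n → Set) →
            (∀ {x y} → Edge F x y → K x y ⊎ Pair x y u w) → (∀ {x y} → K x y → Edge F x y) →
            (∀ {x y} → Edge F′ x y → K x y ⊎ Pair x y u v) → (∀ {x y} → K x y ⊎ Pair x y u v → Edge F′ x y) →
            (∀ {x y} → K x y → ¬ Pair x y u w) → Rewired v u w F′
  rewired {v} {u} {w} {F′} K e⁻ e⁺ e′⁻ e′⁺ k x y = mk⇔ to from
    where
    to : Edge F′ x y → (Edge F x y × ¬ Pair x y u w) ⊎ Pair x y u v
    to e with e′⁻ e
    ... | inj₁ κ  = inj₁ (e⁺ κ , k κ)
    ... | inj₂ uv = inj₂ uv
    from : (Edge F x y × ¬ Pair x y u w) ⊎ Pair x y u v → Edge F′ x y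
    from (inj₂ uv)      = e′⁺ (inj₂ uv)
    from (inj₁ (e , ≢)) with e⁻ e
    ... | inj₁ κ  = e′⁺ (inj₁ κ)
    ... | inj₂ uw = contradiction uw ≢

  Pair⇒~ : ∀ {a b x y} → a ~ b → Pair x y a b → x ~ y
  Pair⇒~ a~b (inj₁ (refl , refl)) = a~b
  Pair⇒~ a~b (inj₂ (refl , refl)) = ~-sym a~b

  Nbr-apart : ∀ {l : List (Fin n)} {x y u w} → Nbr l x y → u ∉ₗ l ⊎ w ∉ₗ l → ¬ Pair x y u w
  Nbr-apart j (inj₁ u∉) (inj₁ (refl , refl)) = u∉ (Nbr-∈ j)
  Nbr-apart j (inj₁ u∉) (inj₂ (refl , refl)) = u∉ (Nbr-∈ (Nbr-sym j))
  Nbr-apart j (inj₂ w∉) (inj₁ (refl , refl)) = w∉ (Nbr-∈ (Nbr-sym j))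
  Nbr-apart j (inj₂ w∉) (inj₂ (refl , refl)) = w∉ (Nbr-∈ j)

  NbrIn-apart : ∀ {ps : List (List⁺ (Fin n))} {x y u w} → NbrIn ps x y → u ∉ₗ vertices ps → ¬ Pair x y u w
  NbrIn-apart j u∉ (inj₁ (refl , refl)) = u∉ (NbrIn-∈ j)
  NbrIn-apart j u∉ (inj₂ (refl , refl)) = u∉ (NbrIn-∈ (NbrIn-sym j))

  reverse-∷-++ : ∀ (v : Fin n) t m → reverse t ++ v ∷ m ≡ reverse (v ∷ t) ++ m
  reverse-∷-++ v t m = trans (sym (++-assoc (reverse t) (v ∷ []) m)) (cong (_++ m) (sym (unfold-reverse v t)))

  Nbr-joined⁻ : ∀ {v u : Fin n} t ys {x y} → Nbr (reverse t ++ v ∷ u ∷ ys) x y →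
                Nbr (v ∷ t) x y ⊎ Pair x y u v ⊎ Nbr (u ∷ ys) x y
  Nbr-joined⁻ {v} t ys {x} {y} j with Nbr-split (reverse t) j
  ... | inj₁ i        = inj₁ (Nbr-unreverse (subst (λ l → Nbr l x y) (sym (unfold-reverse v t)) i))
  ... | inj₂ (inj₁ i) = inj₂ (inj₁ (Pair-swap i))
  ... | inj₂ (inj₂ i) = inj₂ (inj₂ i)

  Nbr-joined⁺ : ∀ {v u : Fin n} t ys {x y} → Nbr (v ∷ t) x y ⊎ Pair x y u v ⊎ Nbr (u ∷ ys) x y →
                Nbr (reverse t ++ v ∷ u ∷ ys) x y
  Nbr-joined⁺ {v} t ys {x} {y} j = Nbr-unsplit (reverse t) (Sum.map
    (λ i → subst (λ l → Nbr l x y) (unfold-reverse v t) (Nbr-reverse i)) (Sum.map₁ Pair-swap) j)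

  joined-↭ : ∀ {v u : Fin n} t ys → reverse t ++ v ∷ u ∷ ys ↭ (v ∷ t) ++ u ∷ ys
  joined-↭ {v} {u} t ys = ↭-trans (↭-reflexive (reverse-∷-++ v t (u ∷ ys))) (Perm.++⁺ʳ (u ∷ ys) (↭-reverse (v ∷ t)))

  -- The part of the path from v to w is reversed and attached to u by its
  -- end v.
  rotate-same : ∀ {v u w zs xs ys} → Traverses F (v ∷ zs) → v ∷ zs ≡ xs ++ w ∷ u ∷ ys → v ~ u →
                ∃[ F′ ] #paths F′ ≡ #paths F × Rewired v u w F′
  rotate-same {v} {u} {w} {zs} {xs} {ys} tr eq v~u with rest , s ← split tr = result xs eq
    where
    open Split s
    result : ∀ xs → v ∷ zs ≡ xs ++ w ∷ u ∷ ys → ∃[ F′ ] #paths F′ ≡ #paths F × Rewired v u w F′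
    result xs eq = with-start (start xs eq)
      where
      start : ∀ xs → v ∷ zs ≡ xs ++ w ∷ u ∷ ys → ∃[ t ] v ∷ t ≡ xs ++ w ∷ []
      start []       e = [] , cong (_∷ []) (∷-injectiveˡ e)
      start (x ∷ xs) e = xs ++ w ∷ [] , cong (_∷ (xs ++ w ∷ [])) (∷-injectiveˡ e)
      with-start : ∃[ t ] v ∷ t ≡ xs ++ w ∷ [] → ∃[ F′ ] #paths F′ ≡ #paths F × Rewired v u w F′
      with-start (t , t≡) = F′ , sym #rest , rewired {F′ = F′} K e⁻ e⁺ e′⁻ e′⁺ k
        where
        K : Fin n → Fin n → Set
        K x y = Nbr (v ∷ t) x y ⊎ Nbr (u ∷ ys) x y ⊎ NbrIn rest x y
        e⁻ : ∀ {x y} → Edge F x y → K x y ⊎ Pair x y u w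
        e⁻ {x} {y} e with edge⁻ e
        ... | inj₂ j = inj₁ (inj₂ (inj₂ j))
        ... | inj₁ j with Nbr-split xs (subst (λ l → Nbr l x y) eq j)
        ...   | inj₁ i        = inj₁ (inj₁ (subst (λ l → Nbr l x y) (sym t≡) i))
        ...   | inj₂ (inj₁ i) = inj₂ (Pair-swap i)
        ...   | inj₂ (inj₂ i) = inj₁ (inj₂ (inj₁ i))
        e⁺ : ∀ {x y} → K x y → Edge F x y
        e⁺ {x} {y} (inj₁ i) = edge⁺ (inj₁ (subst (λ l → Nbr l x y) (sym eq)
                                (Nbr-unsplit xs (inj₁ (subst (λ l → Nbr l x y) t≡ i)))))
        e⁺ {x} {y} (inj₂ (inj₁ i)) = edge⁺ (inj₁ (subst (λ l → Nbr l x y) (sym eq) (Nbr-unsplit xs (inj₂ (inj₂ i)))))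
        e⁺ (inj₂ (inj₂ i)) = edge⁺ (inj₂ i)
        p : List⁺ (Fin n)
        p = reverse t ++⁺ (v ∷ u ∷ ys)
        p≡ : toList p ≡ reverse t ++ v ∷ u ∷ ys
        p≡ = toList-++⁺ (reverse t) (v ∷ u ∷ ys)
        chunks : v ∷ zs ≡ (v ∷ t) ++ u ∷ ys
        chunks = trans eq (trans (sym (++-assoc xs (w ∷ []) (u ∷ ys))) (cong (_++ u ∷ ys) (sym t≡)))
        verts′ : vertices paths ↭ (v ∷ t) ++ (u ∷ ys) ++ vertices rest
        verts′ = ↭-trans verts (↭-reflexive (trans (cong (_++ vertices rest) chunks) (++-assoc (v ∷ t) (u ∷ ys) _)))
        new : vertices paths ↭ vertices (p ∷ rest)
        new = ↭-trans verts (Perm.++⁺ʳ (vertices rest) (↭-trans (↭-reflexive chunks)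
                (↭-trans (↭-sym (joined-↭ t ys)) (↭-reflexive (sym p≡)))))
        joined⁻ : ∀ {x y} → NbrIn (p ∷ rest) x y → K x y ⊎ Pair x y u v
        joined⁻ (there j) = inj₁ (inj₂ (inj₂ j))
        joined⁻ {x} {y} (here j) with Nbr-joined⁻ t ys (subst (λ l → Nbr l x y) p≡ j)
        ... | inj₁ i        = inj₁ (inj₁ i)
        ... | inj₂ (inj₁ i) = inj₂ i
        ... | inj₂ (inj₂ i) = inj₁ (inj₂ (inj₁ i))
        joined⁺ : ∀ {x y} → K x y ⊎ Pair x y u v → NbrIn (p ∷ rest) x y
        joined⁺ (inj₁ (inj₂ (inj₂ j))) = there j
        joined⁺ {x} {y} (inj₁ (inj₁ j)) = here (subst (λ l → Nbr l x y) (sym p≡) (Nbr-joined⁺ t ys (inj₁ j)))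
        joined⁺ {x} {y} (inj₁ (inj₂ (inj₁ j))) = here (subst (λ l → Nbr l x y) (sym p≡) (Nbr-joined⁺ t ys (inj₂ (inj₂ j))))
        joined⁺ {x} {y} (inj₂ j) = here (subst (λ l → Nbr l x y) (sym p≡) (Nbr-joined⁺ t ys (inj₂ (inj₁ j))))
        F′ : LinearForest G
        F′ = rearrange (p ∷ rest) new (λ j → [ Edge⇒~ F ∘ e⁺ , Pair⇒~ (~-sym v~u) ]′ (joined⁻ j))
        e′⁻ : ∀ {x y} → Edge F′ x y → K x y ⊎ Pair x y u v
        e′⁻ e = joined⁻ (Edge⇒NbrIn F′ e)
        e′⁺ : ∀ {x y} → K x y ⊎ Pair x y u v → Edge F′ x y
        e′⁺ κ = NbrIn⇒Edge F′ (joined⁺ κ)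
        un : Unique ((v ∷ t) ++ (u ∷ ys) ++ vertices rest)
        un = unique-↭ verts′ disjoint
        w∈ : w ∈ₗ v ∷ t
        w∈ = subst (w ∈ₗ_) (sym t≡) (∈-++⁺ʳ xs (here refl))
        k : ∀ {x y} → K x y → ¬ Pair x y u w
        k (inj₁ i)        = Nbr-apart i (inj₁ (λ u∈ → unique-disjoint (v ∷ t) un u∈ (here refl)))
        k (inj₂ (inj₁ i)) = Nbr-apart i (inj₂ (λ w∈′ → unique-disjoint (v ∷ t) un w∈ (∈-++⁺ˡ w∈′)))
        k (inj₂ (inj₂ i)) = NbrIn-apart i (unique-disjoint (u ∷ ys) (unique-++ʳ (v ∷ t) un) (here refl))

  -- The path of v is attached to the part of the other path that starts at u,
  -- and the part that ends at w becomes a path.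
  rotate-other : ∀ {v u w zs as bs} → Traverses F (v ∷ zs) → Traverses F (as ++ w ∷ u ∷ bs) →
                 ¬ SamePath F u v → v ~ u → ∃[ F′ ] #paths F′ ≡ #paths F × Rewired v u w F′
  rotate-other {v} {u} {w} {zs} {as} {bs} tr tr′ apart v~u
    with rest , s ← split₂ tr tr′ (here refl) (∈-++⁺ʳ as (there (here refl))) apart
    = F′ , sym #rest , rewired {F′ = F′} K e⁻ e⁺ e′⁻ e′⁺ k
    where
    open Split₂ s
    K : Fin n → Fin n → Set
    K x y = Nbr (v ∷ zs) x y ⊎ Nbr (as ++ w ∷ []) x y ⊎ Nbr (u ∷ bs) x y ⊎ NbrIn rest x y
    e⁻ : ∀ {x y} → Edge F x y → K x y ⊎ Pair x y u w
    e⁻ e with edge⁻ e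
    ... | inj₁ j        = inj₁ (inj₁ j)
    ... | inj₂ (inj₂ j) = inj₁ (inj₂ (inj₂ (inj₂ j)))
    ... | inj₂ (inj₁ j) with Nbr-split as j
    ...   | inj₁ i        = inj₁ (inj₂ (inj₁ i))
    ...   | inj₂ (inj₁ i) = inj₂ (Pair-swap i)
    ...   | inj₂ (inj₂ i) = inj₁ (inj₂ (inj₂ (inj₁ i)))
    e⁺ : ∀ {x y} → K x y → Edge F x y
    e⁺ (inj₁ j)               = edge⁺ (inj₁ j)
    e⁺ (inj₂ (inj₁ i))        = edge⁺ (inj₂ (inj₁ (Nbr-unsplit as (inj₁ i))))
    e⁺ (inj₂ (inj₂ (inj₁ i))) = edge⁺ (inj₂ (inj₁ (Nbr-unsplit as (inj₂ (inj₂ i)))))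
    e⁺ (inj₂ (inj₂ (inj₂ j))) = edge⁺ (inj₂ (inj₂ j))
    p p′ : List⁺ (Fin n)
    p  = reverse zs ++⁺ (v ∷ u ∷ bs)
    p′ = as ++⁺ (w ∷ [])
    p≡ : toList p ≡ reverse zs ++ v ∷ u ∷ bs
    p≡ = toList-++⁺ (reverse zs) (v ∷ u ∷ bs)
    p′≡ : toList p′ ≡ as ++ w ∷ []
    p′≡ = toList-++⁺ as (w ∷ [])
    verts′ : vertices paths ↭ (v ∷ zs) ++ (as ++ w ∷ []) ++ (u ∷ bs) ++ vertices rest
    verts′ = ↭-trans verts (Perm.++⁺ˡ (v ∷ zs) (↭-reflexive
      (trans (++-assoc as (w ∷ u ∷ bs) (vertices rest)) (sym (++-assoc as (w ∷ []) _)))))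
    new : vertices paths ↭ vertices (p ∷ p′ ∷ rest)
    new = ↭-trans verts′ (↭-trans (Perm.++⁺ˡ (v ∷ zs) (Perm.shifts (as ++ w ∷ []) (u ∷ bs)))
      (↭-trans (↭-reflexive (sym (++-assoc (v ∷ zs) (u ∷ bs) _)))
        (Perm.++⁺ (↭-trans (↭-sym (joined-↭ zs bs)) (↭-reflexive (sym p≡)))
                  (Perm.++⁺ʳ (vertices rest) (↭-reflexive (sym p′≡))))))
    joined⁻ : ∀ {x y} → NbrIn (p ∷ p′ ∷ rest) x y → K x y ⊎ Pair x y u v
    joined⁻ (there (there j)) = inj₁ (inj₂ (inj₂ (inj₂ j)))
    joined⁻ {x} {y} (there (here j)) = inj₁ (inj₂ (inj₁ (subst (λ l → Nbr l x y) p′≡ j)))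
    joined⁻ {x} {y} (here j) with Nbr-joined⁻ zs bs (subst (λ l → Nbr l x y) p≡ j)
    ... | inj₁ i        = inj₁ (inj₁ i)
    ... | inj₂ (inj₁ i) = inj₂ i
    ... | inj₂ (inj₂ i) = inj₁ (inj₂ (inj₂ (inj₁ i)))
    joined⁺ : ∀ {x y} → K x y ⊎ Pair x y u v → NbrIn (p ∷ p′ ∷ rest) x y
    joined⁺ (inj₁ (inj₂ (inj₂ (inj₂ j)))) = there (there j)
    joined⁺ {x} {y} (inj₁ (inj₂ (inj₁ j))) = there (here (subst (λ l → Nbr l x y) (sym p′≡) j))
    joined⁺ {x} {y} (inj₁ (inj₁ j)) = here (subst (λ l → Nbr l x y) (sym p≡) (Nbr-joined⁺ zs bs (inj₁ j)))
    joined⁺ {x} {y} (inj₁ (inj₂ (inj₂ (inj₁ j)))) =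
      here (subst (λ l → Nbr l x y) (sym p≡) (Nbr-joined⁺ zs bs (inj₂ (inj₂ j))))
    joined⁺ {x} {y} (inj₂ j) = here (subst (λ l → Nbr l x y) (sym p≡) (Nbr-joined⁺ zs bs (inj₂ (inj₁ j))))
    F′ : LinearForest G
    F′ = rearrange (p ∷ p′ ∷ rest) new (λ j → [ Edge⇒~ F ∘ e⁺ , Pair⇒~ (~-sym v~u) ]′ (joined⁻ j))
    e′⁻ : ∀ {x y} → Edge F′ x y → K x y ⊎ Pair x y u v
    e′⁻ e = joined⁻ (Edge⇒NbrIn F′ e)
    e′⁺ : ∀ {x y} → K x y ⊎ Pair x y u v → Edge F′ x y
    e′⁺ κ = NbrIn⇒Edge F′ (joined⁺ κ)
    un : Unique ((v ∷ zs) ++ (as ++ w ∷ []) ++ (u ∷ bs) ++ vertices rest)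
    un = unique-↭ verts′ disjoint
    un′ : Unique ((as ++ w ∷ []) ++ (u ∷ bs) ++ vertices rest)
    un′ = unique-++ʳ (v ∷ zs) un
    k : ∀ {x y} → K x y → ¬ Pair x y u w
    k (inj₁ i)               = Nbr-apart i (inj₁ (λ u∈ → unique-disjoint (v ∷ zs) un u∈
                                 (∈-++⁺ʳ (as ++ w ∷ []) (here refl))))
    k (inj₂ (inj₁ i))        = Nbr-apart i (inj₁ (λ u∈ → unique-disjoint (as ++ w ∷ []) un′ u∈ (here refl)))
    k (inj₂ (inj₂ (inj₁ i))) = Nbr-apart i (inj₂ (λ w∈ → unique-disjoint (as ++ w ∷ []) un′
                                 (∈-++⁺ʳ as (here refl)) (∈-++⁺ˡ w∈)))
    k (inj₂ (inj₂ (inj₂ i))) = NbrIn-apart i (unique-disjoint (u ∷ bs) (unique-++ʳ (as ++ w ∷ []) un′) (here refl))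

  -- An edge between ends of distinct paths joins them into one.
  join : ∀ {v u zs bs} → Traverses F (v ∷ zs) → Traverses F (u ∷ bs) → ¬ SamePath F u v → v ~ u →
         ∃[ F′ ] #paths F ≡ suc (#paths F′)
  join {v} {u} {zs} {bs} tr tr′ apart v~u
    with rest , s ← split₂ tr tr′ (here refl) (here refl) apart = rearrange (p ∷ rest) new adj , #rest
    where
    open Split₂ s
    p : List⁺ (Fin n)
    p = reverse zs ++⁺ (v ∷ u ∷ bs)
    p≡ : toList p ≡ reverse zs ++ v ∷ u ∷ bs
    p≡ = toList-++⁺ (reverse zs) (v ∷ u ∷ bs)
    new : vertices paths ↭ vertices (p ∷ rest)
    new = ↭-trans verts (↭-trans (↭-reflexive (sym (++-assoc (v ∷ zs) (u ∷ bs) _)))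
      (Perm.++⁺ʳ (vertices rest) (↭-trans (↭-sym (joined-↭ zs bs)) (↭-reflexive (sym p≡)))))
    adj : ∀ {x y} → NbrIn (p ∷ rest) x y → x ~ y
    adj (there j) = Edge⇒~ F (edge⁺ (inj₂ (inj₂ j)))
    adj {x} {y} (here j) with Nbr-joined⁻ zs bs (subst (λ l → Nbr l x y) p≡ j)
    ... | inj₁ i        = Edge⇒~ F (edge⁺ (inj₁ i))
    ... | inj₂ (inj₁ i) = Pair⇒~ (~-sym v~u) i
    ... | inj₂ (inj₂ i) = Edge⇒~ F (edge⁺ (inj₂ (inj₁ i)))

-- Rotations and endpoints

infixl 6 _⊕_

-- The multiset X with one more copy of v.
_⊕_ : ∀ {n} → Multiset n → Fin n → Multiset n
(X ⊕ v) t = X t + 𝟙 (t ≟ v)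

∈∖⇒< : ∀ {n} {M X : Multiset n} {v} → v ∈ₘ (M ∖ X) → X v < M v
∈∖⇒< {M = M} {X} {v} h with ℕ.<-≤-connex (X v) (M v)
... | inj₁ lt = lt
... | inj₂ ge = contradiction (subst (0 <_) (ℕ.m≤n⇒m∸n≡0 ge) h) (λ ())

<⇒∈∖ : ∀ {n} {M X : Multiset n} {v} → X v < M v → v ∈ₘ (M ∖ X)
<⇒∈∖ = ℕ.m<n⇒0<n∸m

module _ {n : ℕ} {G : Graph n} where
  open Graph G
  open LinearForest

  -- v is an endpoint of F that is not fixed by X, with multiplicity.
  Free : LinearForest G → Multiset n → Fin n → Set
  Free F X v = v ∈ₘ (End F ∖ X)

  free⇒end : ∀ {F : LinearForest G} {X v} → Free F X v → v ∈ₘ End F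
  free⇒end {F} {X} f = ℕ.≤-trans (s≤s z≤n) (∈∖⇒< {M = End F} {X} f)

  free-⊕ : ∀ {F : LinearForest G} {X v t} → Free F (X ⊕ v) t → Free F X t
  free-⊕ {F} {X} {v} f = <⇒∈∖ {M = End F} {X}
    (ℕ.≤-<-trans (ℕ.m≤m+n _ _) (∈∖⇒< {M = End F} {X ⊕ v} f))

  ⊕-⊆ : ∀ {F : LinearForest G} {X v} → X ⊆ₘ End F → Free F X v → (X ⊕ v) ⊆ₘ End F
  ⊕-⊆ {F} {X} {v} X⊆ f t with t ≟ v
  ... | yes refl = subst (_≤ End F t) (ℕ.+-comm 1 (X t)) (∈∖⇒< {M = End F} {X} f)
  ... | no _     = subst (_≤ End F t) (sym (ℕ.+-identityʳ (X t))) (X⊆ t)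

  family-⊕ : ∀ {F : LinearForest G} {X v F′} → Family F (X ⊕ v) F′ → Family F X F′
  family-⊕ ε = ε
  family-⊕ {F} {X} {v} ((x , f , ρ) ◅ s) = (x , free-⊕ {F} {X} {v} f , ρ) ◅ family-⊕ {X = X} {v} s

  -- Endpoints are determined by the edges, through End F x + deg F x = 2.
  degree≤⇒End≥ : ∀ (F F′ : LinearForest G) x k → degreeᶠ F′ x ≤ k + degreeᶠ F x → End F x ≤ k + End F′ x
  degree≤⇒End≥ F F′ x k h = ℕ.+-cancelʳ-≤ (degreeᶠ F x) (End F x) (k + End F′ x) (begin
    End F x + degreeᶠ F x          ≡⟨ trans (End+degree F x) (sym (End+degree F′ x)) ⟩
    End F′ x + degreeᶠ F′ x        ≤⟨ ℕ.+-monoʳ-≤ (End F′ x) h ⟩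
    End F′ x + (k + degreeᶠ F x)   ≡⟨ sym (ℕ.+-assoc (End F′ x) k _) ⟩
    End F′ x + k + degreeᶠ F x     ≡⟨ cong (_+ degreeᶠ F x) (ℕ.+-comm (End F′ x) k) ⟩
    k + End F′ x + degreeᶠ F x     ∎)
    where open ℕ.≤-Reasoning

  degree<⇒End> : ∀ (F F′ : LinearForest G) x → degreeᶠ F′ x < degreeᶠ F x → End F x < End F′ x
  degree<⇒End> F F′ x h = ℕ.+-cancelʳ-≤ (degreeᶠ F′ x) (suc (End F x)) (End F′ x) (begin
    suc (End F x) + degreeᶠ F′ x   ≡⟨ sym (ℕ.+-suc (End F x) _) ⟩
    End F x + suc (degreeᶠ F′ x)   ≤⟨ ℕ.+-monoʳ-≤ (End F x) h ⟩
    End F x + degreeᶠ F x          ≡⟨ trans (End+degree F x) (sym (End+degree F′ x)) ⟩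
    End F′ x + degreeᶠ F′ x        ∎)
    where open ℕ.≤-Reasoning

  same-edges⇒#paths : ∀ (F F′ : LinearForest G) → (∀ x y → Edge F x y → Edge F′ x y) → (∀ x y → Edge F′ x y → Edge F x y) →
                      #paths F ≡ #paths F′
  same-edges⇒#paths F F′ to from = ℕ.*-cancelˡ-≡ (#paths F) (#paths F′) 2
    (trans (sym (size-End F)) (trans (sum-cong-≗ same-End) (size-End F′)))
    where
    same-End : ∀ x → End F x ≡ End F′ x
    same-End x = ℕ.≤-antisym
      (degree≤⇒End≥ F F′ x 0 (count-mono (edge? F′ x) (edge? F x) (from x)))
      (degree≤⇒End≥ F′ F x 0 (count-mono (edge? F x) (edge? F′ x) (to x)))

  realise : ∀ {F : LinearForest G} {v u w} → v ∈ₘ End F → v ~ u → NewEnd F v u w →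
            ∃[ F′ ] #paths F′ ≡ #paths F × Rewired F v u w F′
  realise {F} v∈ v~u (same tr eq) = rotate-same F tr eq v~u
  realise {F} v∈ v~u (other apart e) with zs , tr ← end-reading F v∈ with xs , ys , tr′ ← Edge-sym F e =
    rotate-other F tr tr′ apart v~u

  -- F′ is known through its edges only, but it has the same edges as the
  -- forest with equally many paths as F obtained by cutting and joining.
  rotation-#paths : ∀ {F F′ : LinearForest G} {v} → Rotation F v F′ → #paths F′ ≡ #paths F
  rotation-#paths {F} {F′} ρ with F* , # , rw ← realise (Rotation.endpoint ρ) (Rotation.adjacent ρ) (Rotation.newEnd ρ) =
    trans (same-edges⇒#paths F′ F* (λ x y e → Equivalence.from (rw x y) (Equivalence.to (edges x y) e))
                                   (λ x y e → Equivalence.from (edges x y) (Equivalence.to (rw x y) e))) #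
    where open Rotation ρ

  module _ {F : LinearForest G} {v : Fin n} {F′ : LinearForest G} (ρ : Rotation F v F′) where
    open Rotation ρ

    removed : Edge F u w
    removed with newEnd
    ... | other _ e = e
    ... | same {xs} {ys} tr eq = Edge-sym F (xs , ys , subst (Traverses F) eq tr)

    edge-back : ∀ {x y} → Edge F′ x y → Edge F x y × ¬ Pair x y u w ⊎ Pair x y u v
    edge-back {x} {y} = Equivalence.to (edges x y)

    u≢v : u ≢ v
    u≢v refl = ~-irrefl refl adjacent

    u≢w : u ≢ w
    u≢w refl = ~-irrefl refl (Edge⇒~ F removed)

    degree-other : ∀ {x} → x ≢ v → degreeᶠ F′ x ≤ degreeᶠ F x
    degree-other {x} x≢v with x ≟ u
    ... | yes refl = subst (degreeᶠ F′ u ≤_) (sym (count-remove (edge? F u) w removed))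
            (count-cover (edge? F′ u) (λ y → edge? F u y ×-dec ¬? (y ≟ w)) v cover)
      where
      cover : ∀ y → Edge F′ u y → (Edge F u y × y ≢ w) ⊎ y ≡ v
      cover y e with edge-back e
      ... | inj₁ (e′ , ≢uw)         = inj₁ (e′ , λ y≡w → ≢uw (inj₁ (refl , y≡w)))
      ... | inj₂ (inj₁ (_ , y≡v))   = inj₂ y≡v
      ... | inj₂ (inj₂ (u≡v , _))   = contradiction u≡v u≢v
    ... | no x≢u = count-mono (edge? F′ x) (edge? F x) kept
      where
      kept : ∀ y → Edge F′ x y → Edge F x y
      kept y e with edge-back e
      ... | inj₁ (e′ , _)           = e′
      ... | inj₂ (inj₁ (x≡u , _))   = contradiction x≡u x≢u
      ... | inj₂ (inj₂ (x≡v , _))   = contradiction x≡v x≢v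

    degree-old : degreeᶠ F′ v ≤ suc (degreeᶠ F v)
    degree-old = count-cover (edge? F′ v) (edge? F v) u cover
      where
      cover : ∀ y → Edge F′ v y → Edge F v y ⊎ y ≡ u
      cover y e with edge-back e
      ... | inj₁ (e′ , _)           = inj₁ e′
      ... | inj₂ (inj₁ (v≡u , _))   = contradiction (sym v≡u) u≢v
      ... | inj₂ (inj₂ (_ , y≡u))   = inj₂ y≡u

    degree-trivial : w ≡ v → degreeᶠ F′ v ≤ degreeᶠ F v
    degree-trivial refl = count-mono (edge? F′ v) (edge? F v) kept
      where
      kept : ∀ y → Edge F′ v y → Edge F v y
      kept y e with edge-back e
      ... | inj₁ (e′ , _)               = e′
      ... | inj₂ (inj₁ (v≡u , _))       = contradiction (sym v≡u) u≢v
      ... | inj₂ (inj₂ (refl , refl))   = Edge-sym F removed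

    degree-new : w ≢ v → degreeᶠ F′ w < degreeᶠ F w
    degree-new w≢v = subst (suc (degreeᶠ F′ w) ≤_) (sym (count-remove (edge? F w) u (Edge-sym F removed)))
      (s≤s (count-mono (edge? F′ w) (λ y → edge? F w y ×-dec ¬? (y ≟ u)) kept))
      where
      kept : ∀ y → Edge F′ w y → Edge F w y × y ≢ u
      kept y e with edge-back e
      ... | inj₁ (e′ , ≢uw)         = e′ , λ y≡u → ≢uw (inj₂ (refl , y≡u))
      ... | inj₂ (inj₁ (w≡u , _))   = contradiction (sym w≡u) u≢w
      ... | inj₂ (inj₂ (w≡v , _))   = contradiction w≡v w≢v

    module _ {X : Multiset n} (X⊆ : X ⊆ₘ End F) (free : Free F X v) where

      still-fixed : X ⊆ₘ End F′
      still-fixed x with x ≟ v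
      ... | yes refl = s≤s⁻¹ (ℕ.≤-trans (∈∖⇒< {M = End F} {X} free) (degree≤⇒End≥ F F′ v 1 degree-old))
      ... | no x≢v   = ℕ.≤-trans (X⊆ x) (degree≤⇒End≥ F F′ x 0 (degree-other x≢v))

      new-free : Free F′ X w
      new-free with w ≟ v
      ... | yes refl = <⇒∈∖ {M = End F′} {X}
              (ℕ.≤-trans (∈∖⇒< {M = End F} {X} free) (degree≤⇒End≥ F F′ v 0 (degree-trivial refl)))
      ... | no w≢v   = <⇒∈∖ {M = End F′} {X} (ℕ.≤-<-trans (X⊆ w) (degree<⇒End> F F′ w (degree-new w≢v)))

  family-minimum : ∀ {F F′ : LinearForest G} {X} → Family F X F′ → Minimum F → Minimum F′
  family-minimum ε min = min
  family-minimum {X = X} ((v , f , ρ) ◅ s) min =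
    family-minimum {X = X} s (λ F″ → subst (_≤ #paths F″) (sym (rotation-#paths ρ)) (min F″))

  family-fixed : ∀ {F F′ : LinearForest G} {X} → Family F X F′ → X ⊆ₘ End F → X ⊆ₘ End F′
  family-fixed ε X⊆ = X⊆
  family-fixed ((v , f , ρ) ◅ s) X⊆ = family-fixed s (still-fixed ρ X⊆ f)

-- An endpoint of a minimum forest and a vertex adjacent to it

  apart-reading : ∀ (F : LinearForest G) {p q u v} → p ∈ₗ paths F → Reading p q → v ∈ₗ q → u ∉ₗ q → ¬ SamePath F u v
  apart-reading F p∈ r v∈ u∉ (p′ , p′∈ , u∈ , v∈′)
    with refl ← same-path F p∈ p′∈ (∈-resp-↭ (reading-↭ r) v∈) v∈′ = u∉ (∈-resp-↭ (↭-sym (reading-↭ r)) u∈)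

  minimum-join : ∀ {F : LinearForest G} {v u zs bs} → Minimum F → Traverses F (v ∷ zs) → Traverses F (u ∷ bs) →
                 ¬ SamePath F u v → ¬ (v ~ u)
  minimum-join {F} min tr tr′ apart v~u with F′ , # ← join F tr tr′ apart v~u =
    ℕ.<-irrefl refl (ℕ.≤-trans (ℕ.≤-reflexive (sym #)) (min F′))

  -- Either u is on the path of v, preceded by w when that path is read from
  -- v, or u is on another path and has two neighbours there.
  data Position (F : LinearForest G) (v u : Fin n) : Set where
    own     : ∀ {xs w ys zs} → Traverses F (v ∷ zs) → v ∷ zs ≡ xs ++ w ∷ u ∷ ys → Position F v u
    foreign : ∀ {a b} → ¬ SamePath F u v → Edge F u a → Edge F u b → a ≢ b → Position F v u

  position : ∀ {F : LinearForest G} {v u} → Minimum F → v ∈ₘ End F → v ~ u → Position F v u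
  position {F} {v} {u} min v∈ v~u with zs , tr@(p , p∈ , r) ← end-reading F v∈ with u ∈? (v ∷ zs)
  ... | no u∉ with p′ , p′∈ , u∈ ← vertices-∈ (paths F) (spanning F u) with as , bs , eq ← ∈-∃++ u∈ = inner bs (unsnoc as) eq
    where
    apart : ¬ SamePath F u v
    apart = apart-reading F p∈ r (here refl) u∉
    inner : ∀ {as} bs → as ≡ [] ⊎ ∃[ xs ] ∃[ x ] as ≡ xs ++ x ∷ [] → toList p′ ≡ as ++ u ∷ bs → Position F v u
    inner bs (inj₁ refl) eq = contradiction v~u (minimum-join {F} min tr (p′ , p′∈ , inj₁ (sym eq)) apart)
    inner {as} [] (inj₂ _) eq = contradiction v~u (minimum-join {F} min tr
      (p′ , p′∈ , inj₂ (sym (trans (cong reverse eq) (reverse-++ as (u ∷ []))))) apart)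
    inner (b ∷ bs) (inj₂ (as , a , refl)) eq = foreign apart
      (Nbr⇒Edge F p′∈ (subst (λ l → Nbr l u a) (sym eq′) (Nbr-++ʳ as bwd)))
      (Nbr⇒Edge F p′∈ (subst (λ l → Nbr l u b) (sym eq) (Nbr-++ʳ (as ++ a ∷ []) fwd)))
      (λ { refl → unique-disjoint (as ++ a ∷ []) (subst Unique eq (unique-path F p′∈))
                    (∈-++⁺ʳ as (here refl)) (there (here refl)) })
      where
      eq′ : toList p′ ≡ as ++ a ∷ u ∷ b ∷ bs
      eq′ = trans eq (++-assoc as (a ∷ []) (u ∷ b ∷ bs))
  ... | yes u∈ with xs , ys , eq ← ∈-∃++ u∈ with unsnoc xs
  ...   | inj₁ refl            = contradiction v~u (~-irrefl (∷-injectiveˡ eq))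
  ...   | inj₂ (xs′ , w , refl) = own {ys = ys} tr (trans eq (++-assoc xs′ (w ∷ []) (u ∷ ys)))

  own-edge : ∀ {F : LinearForest G} {v xs w u ys zs} → Traverses F (v ∷ zs) → v ∷ zs ≡ xs ++ w ∷ u ∷ ys → Edge F u w
  own-edge {F} {xs = xs} {ys = ys} tr eq = Edge-sym F (xs , ys , subst (Traverses F) eq tr)

  -- If u lies between two distinct ends of its path, then the predecessors of
  -- u in the readings from the two ends differ.
  own-own : ∀ {F : LinearForest G} {v v′ xs w u ys zs xs′ ys′ zs′} → v ≢ v′ →
            Traverses F (v ∷ zs) → v ∷ zs ≡ xs ++ w ∷ u ∷ ys →
            Traverses F (v′ ∷ zs′) → v′ ∷ zs′ ≡ xs′ ++ w ∷ u ∷ ys′ → ⊥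
  own-own {F} {v} {v′} {xs} {w} {u} {ys} {zs} {xs′} {ys′} {zs′} v≢v′ (p , p∈ , r) eq (p′ , p′∈ , r′) eq′
    with refl ← same-path F p∈ p′∈
           (∈-resp-↭ (reading-↭ r) (subst (u ∈ₗ_) (sym eq) (∈-++⁺ʳ xs (there (here refl)))))
           (∈-resp-↭ (reading-↭ r′) (subst (u ∈ₗ_) (sym eq′) (∈-++⁺ʳ xs′ (there (here refl))))) = go r r′
    where
    reversed : v′ ∷ zs′ ≡ reverse (v ∷ zs) → ⊥
    reversed e = unique-order xs (reverse ys′) (unique-↭ (↭-sym (reading-↭ r)) (unique-path F p∈)) eq (begin
      v ∷ zs                             ≡⟨ sym (reverse-involutive (v ∷ zs)) ⟩
      reverse (reverse (v ∷ zs))         ≡⟨ cong reverse (trans (sym e) eq′) ⟩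
      reverse (xs′ ++ w ∷ u ∷ ys′)       ≡⟨ reverse-++ xs′ _ ⟩
      reverse (w ∷ u ∷ ys′) ++ reverse xs′   ≡⟨ cong (_++ reverse xs′) (reverse-++ (w ∷ u ∷ []) ys′) ⟩
      (reverse ys′ ++ u ∷ w ∷ []) ++ reverse xs′ ≡⟨ ++-assoc (reverse ys′) _ _ ⟩
      reverse ys′ ++ u ∷ w ∷ reverse xs′ ∎)
      where open ≡-Reasoning
    go : Reading p (v ∷ zs) → Reading p (v′ ∷ zs′) → ⊥
    go (inj₁ e) (inj₁ e′) = v≢v′ (∷-injectiveˡ (trans e (sym e′)))
    go (inj₂ e) (inj₂ e′) = v≢v′ (∷-injectiveˡ (trans e (sym e′)))
    go (inj₁ e) (inj₂ e′) = reversed (trans e′ (cong reverse (sym e)))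
    go (inj₂ e) (inj₁ e′) = reversed (trans e′ (trans (sym (reverse-involutive (toList p))) (cong reverse (sym e))))

  -- A vertex that is an endpoint twice is isolated.
  isolated : ∀ {F : LinearForest G} {v y} → 2 ≤ End F v → ¬ Edge F v y
  isolated {F} {v} {y} two e = ℕ.<⇒≱ (positive-count (edge? F v) y e)
    (ℕ.+-cancelˡ-≤ (End F v) (degreeᶠ F v) 0 (ℕ.≤-trans (ℕ.≤-reflexive (End+degree F v))
      (ℕ.≤-trans two (ℕ.≤-reflexive (sym (ℕ.+-identityʳ _))))))

  own⇒edge : ∀ {F : LinearForest G} {v xs w u ys zs} → Traverses F (v ∷ zs) → v ∷ zs ≡ xs ++ w ∷ u ∷ ys → ∃[ y ] Edge F v y
  own⇒edge {zs = b ∷ zs} tr eq = b , [] , zs , tr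
  own⇒edge {xs = []}         {zs = []} tr ()
  own⇒edge {xs = _ ∷ []}     {zs = []} tr ()
  own⇒edge {xs = _ ∷ _ ∷ xs} {zs = []} tr ()

  -- The ends of the path of u account for every endpoint in the closed
  -- neighbourhood of an endpoint u, so there are at most two of them.
  at-most-two : ∀ {F : LinearForest G} {u z y} → Minimum F → z ≡ u ⊎ u ~ z → y ≡ u ⊎ u ~ y →
                ¬ multiset (u ∷ z ∷ y ∷ []) ⊆ₘ End F
  at-most-two {F} {u} {z} {y} min nz ny ⊆End with p , p∈ , u∈ ← vertices-∈ (paths F) (spanning F u) =
    contradiction (subst₂ _≤_ (size-multiset (u ∷ z ∷ y ∷ [])) (size-multiset (head p ∷ last p ∷ [])) (sum-mono bound))
                  λ { (s≤s (s≤s ())) }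
    where
    ends : ∀ {t} → t ∈ₗ u ∷ z ∷ y ∷ [] → t ∈ₘ End F
    ends {t} t∈ = ℕ.≤-trans (∈-multiset (u ∷ z ∷ y ∷ []) t∈) (⊆End t)
    on-path : ∀ {t} → t ≡ u ⊎ u ~ t → t ∈ₘ End F → t ∈ₗ toList p
    on-path (inj₁ refl) _ = u∈
    on-path {t} (inj₂ u~t) te with t ∈? toList p
    ... | yes t∈ = t∈
    ... | no t∉ with zs , tr ← end-reading F (ends (here refl)) with _ , tr′ ← end-reading F te =
      contradiction u~t (minimum-join {F} min tr tr′ (apart-reading F p∈ (inj₁ refl) u∈ t∉))
    member : ∀ {t} → t ∈ₗ u ∷ z ∷ y ∷ [] → t ∈ₗ toList p
    member (here refl)                 = u∈
    member (there (here refl))         = on-path nz (ends (there (here refl)))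
    member (there (there (here refl))) = on-path ny (ends (there (there (here refl))))
    bound : ∀ t → multiset (u ∷ z ∷ y ∷ []) t ≤ multiset (head p ∷ last p ∷ []) t
    bound t with t ∈? (u ∷ z ∷ y ∷ [])
    ... | yes t∈ = ℕ.≤-trans (⊆End t) (ℕ.≤-reflexive (End-on-path F p∈ (member t∈)))
    ... | no t∉  = ℕ.≤-trans (ℕ.≤-reflexive (multiset-∉ (u ∷ z ∷ y ∷ []) t∉)) z≤n

-- The set C(F, X) and its closure properties

-- F is a minimum forest and X consists of endpoints of F.
module Closure {n : ℕ} {G : Graph n} (F : LinearForest G) (min : Minimum F)
               (X : Multiset n) (X⊆ : X ⊆ₘ End F) where
  open Graph G

  -- Every admissible choice of a new endpoint is realised by a rotation, so
  -- the new endpoint is in C(F, X).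
  closed : ∀ {F′ v u w} → Family F X F′ → Free F′ X v → v ~ u → NewEnd F′ v u w → C F X w
  closed {F′} {v} {u} {w} fam free v~u ne
    with F″ , _ , rw ← realise {F = F′} (free⇒end {F = F′} {X} free) v~u ne =
    F″ , fam ◅◅ ((v , free , ρ) ◅ ε) , new-free ρ (family-fixed fam X⊆) free
    where
    ρ : Rotation F′ v F″
    ρ = record { endpoint = free⇒end {F = F′} {X} free ; adjacent = v~u ; newEnd = ne ; edges = rw }

  position-in : ∀ {F′ v u} → Family F X F′ → Free F′ X v → v ~ u → Position F′ v u
  position-in {F′} fam free v~u = position {F = F′} (family-minimum {X = X} fam min) (free⇒end {F = F′} {X} free) v~u

  -- u has no neighbour in C(F, X) along F′.
  None : LinearForest G → Fin n → Set
  None F′ u = ∀ a → C F X a → ¬ Edge F′ u a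

  -- u has at most one neighbour in C(F, X) along F′.
  AtMostOne : LinearForest G → Fin n → Set
  AtMostOne F′ u = ∀ a b → C F X a → C F X b → Edge F′ u a → Edge F′ u b → a ≡ b

  free-neighbour : ∀ {F′ v u} → Family F X F′ → Free F′ X v → v ~ u → ¬ None F′ u
  free-neighbour {F′} fam free v~u none with position-in fam free v~u
  ... | own tr eq            = none _ (closed fam free v~u (same tr eq)) (own-edge {F = F′} tr eq)
  ... | foreign apart ua _ _ = none _ (closed fam free v~u (other apart ua)) ua

  -- Two free endpoints, counted with multiplicity, adjacent to u give two
  -- different new endpoints, both neighbours of u in F′.
  two-free-neighbours : ∀ {F′ v v′ u} → Family F X F′ → AtMostOne F′ u →
                        Free F′ X v → Free F′ (X ⊕ v) v′ → v ~ u → ¬ (v′ ~ u)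
  two-free-neighbours {F′} {v} {v′} {u} fam one free free′ v~u v′~u =
    by-position (position-in fam free v~u) (position-in fam f′ v′~u)
    where
    f′ : Free F′ X v′
    f′ = free-⊕ {F = F′} {X} {v} free′
    twice : v′ ≡ v → 2 ≤ End F′ v
    twice v′≡v = ℕ.≤-trans (s≤s (ℕ.≤-trans (ℕ.≤-reflexive (sym (𝟙-yes (v ≟ v) refl))) (ℕ.m≤n+m _ (X v))))
                   (∈∖⇒< {M = End F′} {X ⊕ v} (subst (Free F′ (X ⊕ v)) v′≡v free′))
    by-position : Position F′ v u → Position F′ v′ u → ⊥
    by-position (foreign apart ua ub a≢b) _ =
      a≢b (one _ _ (closed fam free v~u (other apart ua)) (closed fam free v~u (other apart ub)) ua ub)
    by-position (own _ _) (foreign apart ua ub a≢b) =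
      a≢b (one _ _ (closed fam f′ v′~u (other apart ua)) (closed fam f′ v′~u (other apart ub)) ua ub)
    by-position (own {w = w} tr eq) (own {xs = xs′} {w = w′} {ys = ys′} {zs = zs′} tr′ eq′) = by-ends (v′ ≟ v)
      where
      w≡w′ : w ≡ w′
      w≡w′ = one w w′ (closed fam free v~u (same tr eq)) (closed fam f′ v′~u (same tr′ eq′))
                      (own-edge {F = F′} tr eq) (own-edge {F = F′} tr′ eq′)
      by-ends : Dec (v′ ≡ v) → ⊥
      by-ends (yes v′≡v) = isolated {F = F′} (twice v′≡v) (proj₂ (own⇒edge {F = F′} tr eq))
      by-ends (no v′≢v)  = own-own {F = F′} {ys′ = ys′} (v′≢v ∘ sym) tr eq tr′
                             (subst (λ x → v′ ∷ zs′ ≡ xs′ ++ x ∷ u ∷ ys′) (sym w≡w′) eq′)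

  -- The rotation gives new neighbours to its centre u and to v only, and it
  -- replaces the neighbour w of u, which is in C(F, X), by v.
  module _ {F₁ F₂ : LinearForest G} {v : Fin n} (fam : Family F X F₁) (free : Free F₁ X v)
           (ρ : Rotation F₁ v F₂) where
    open Rotation ρ using (u; w; adjacent; newEnd)

    none-step : ∀ {z} → v ≢ z → None F₁ z → None F₂ z
    none-step v≢z none a ca e with edge-back ρ e
    ... | inj₁ (e′ , _)               = none a ca e′
    ... | inj₂ (inj₁ (refl , refl))   = none w (closed fam free adjacent newEnd) (removed ρ)
    ... | inj₂ (inj₂ (refl , _))      = v≢z refl

    atMostOne-step : ∀ {z} → v ≢ z → AtMostOne F₁ z → AtMostOne F₂ z
    atMostOne-step v≢z one a b ca cb ea eb with edge-back ρ ea | edge-back ρ eb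
    ... | inj₂ (inj₂ (refl , _)) | _ = contradiction refl v≢z
    ... | _ | inj₂ (inj₂ (refl , _)) = contradiction refl v≢z
    ... | inj₁ (ea′ , _) | inj₁ (eb′ , _) = one a b ca cb ea′ eb′
    ... | inj₂ (inj₁ (refl , refl)) | inj₂ (inj₁ (_ , refl)) = refl
    ... | inj₁ (ea′ , ≢uw) | inj₂ (inj₁ (refl , refl)) =
      contradiction (inj₁ (refl , one a w ca (closed fam free adjacent newEnd) ea′ (removed ρ))) ≢uw
    ... | inj₂ (inj₁ (refl , refl)) | inj₁ (eb′ , ≢uw) =
      contradiction (inj₁ (refl , one b w cb (closed fam free adjacent newEnd) eb′ (removed ρ))) ≢uw

  -- Until u or x is rotated, neither has a neighbour in C(F, X) along the
  -- forest, so neither can be a free endpoint as the other would need one.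
  none-independent : ∀ {u x} → None F u → None F x → C F X x → ¬ (x ~ u)
  none-independent {u} {x} nu nx (F′ , fam , free) x~u = go ε nu nx fam
    where
    go : ∀ {F₁} → Family F X F₁ → None F₁ u → None F₁ x → Family F₁ X F′ → ⊥
    go {F₁} fam nu nx ε = free-neighbour {F₁} fam free x~u nu
    go {F₁} fam nu nx ((v , f , ρ) ◅ s) =
      go (fam ◅◅ ((v , f , ρ) ◅ ε))
         (none-step fam f ρ (λ { refl → free-neighbour {F₁} fam f (~-sym x~u) nx }) nu)
         (none-step fam f ρ (λ { refl → free-neighbour {F₁} fam f x~u nu }) nx) s

  outside-none : ∀ {u x} → ¬ C F X u → None F u → C F X x → ¬ (x ~ u)
  outside-none {u} {x} ¬cu nu (F′ , fam , free) x~u = go ε nu fam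
    where
    go : ∀ {F₁} → Family F X F₁ → None F₁ u → Family F₁ X F′ → ⊥
    go {F₁} fam nu ε = free-neighbour {F₁} fam free x~u nu
    go {F₁} fam nu ((v , f , ρ) ◅ s) =
      go (fam ◅◅ ((v , f , ρ) ◅ ε)) (none-step fam f ρ (λ { refl → ¬cu (F₁ , fam , f) }) nu) s

  -- For x adjacent to u, either condition keeps u from being a free endpoint.
  Guard : LinearForest G → Fin n → Fin n → Set
  Guard F′ u x = ¬ C F X u ⊎ None F′ x

  -- On the way to a forest in which x is a free endpoint, stop as soon as it
  -- is one: until then x is not rotated, and u never is.
  approach : ∀ {u x} → AtMostOne F u → Guard F u x → x ~ u → C F X x →
             ∃[ F₁ ] Family F X F₁ × Free F₁ X x × AtMostOne F₁ u × Guard F₁ u x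
  approach {u} {x} one guard x~u (F′ , fam , free) = go ε one guard fam
    where
    go : ∀ {F₁} → Family F X F₁ → AtMostOne F₁ u → Guard F₁ u x → Family F₁ X F′ →
         ∃[ F₂ ] Family F X F₂ × Free F₂ X x × AtMostOne F₂ u × Guard F₂ u x
    go fam one guard ε = _ , fam , free , one , guard
    go {F₁} fam one guard ((v , f , ρ) ◅ s) with v ≟ x
    ... | yes refl = F₁ , fam , f , one , guard
    ... | no v≢x   = go (fam ◅◅ ((v , f , ρ) ◅ ε)) (atMostOne-step fam f ρ (v≢u guard) one)
                        (Sum.map₂ (none-step fam f ρ v≢x) guard) s
      where
      v≢u : Guard F₁ u x → v ≢ u
      v≢u (inj₁ ¬cu) refl = ¬cu (F₁ , fam , f)
      v≢u (inj₂ nx)  refl = free-neighbour {F₁} fam f (~-sym x~u) nx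

  -- Once x is fixed, no further endpoint adjacent to u can become free: with
  -- x it would give u two neighbours in C(F, X).
  frozen : ∀ {F₁ u x y} → Family F X F₁ → Free F₁ X x → AtMostOne F₁ u → Guard F₁ u x → x ~ u →
           y ~ u → ¬ C F₁ (X ⊕ x) y
  frozen {F₁} {u} {x} {y} fam free one guard x~u y~u (F′ , famˣ , freeʸ) =
    go fam (⊕-⊆ {F = F₁} {X} (family-fixed fam X⊆) free) one guard famˣ
    where
    x-free : ∀ {F₂} → (X ⊕ x) ⊆ₘ End F₂ → Free F₂ X x
    x-free {F₂} X⊕x⊆ = <⇒∈∖ {M = End F₂} {X} (ℕ.≤-trans
      (ℕ.≤-reflexive (trans (ℕ.+-comm 1 (X x)) (cong (X x +_) (sym (𝟙-yes (x ≟ x) refl))))) (X⊕x⊆ x))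
    go : ∀ {F₂} → Family F X F₂ → (X ⊕ x) ⊆ₘ End F₂ → AtMostOne F₂ u → Guard F₂ u x →
         Family F₂ (X ⊕ x) F′ → ⊥
    go {F₂} fam fixed one guard ε = two-free-neighbours {F₂} fam one (x-free {F₂} fixed) freeʸ x~u y~u
    go {F₂} fam fixed one guard ((v , f , ρ) ◅ s) =
      go (fam ◅◅ ((v , f′ , ρ) ◅ ε)) (still-fixed ρ {X ⊕ x} fixed f)
         (atMostOne-step fam f′ ρ (v≢u guard) one)
         (Sum.map₂ (none-step fam f′ ρ λ { refl → two-free-neighbours {F₂} fam one (x-free {F₂} fixed) f x~u x~u }) guard) s
      where
      f′ : Free F₂ X v
      f′ = free-⊕ {F = F₂} {X} {x} f
      v≢u : Guard F₂ u x → v ≢ u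
      v≢u (inj₁ ¬cu) refl = ¬cu (F₂ , fam , f′)
      v≢u (inj₂ nx)  refl = free-neighbour {F₂} fam f′ (~-sym x~u) nx

-- If u and an endpoint z in the closed neighbourhood of u are both fixed, then
-- no other free endpoint lies in that neighbourhood.
crowded : ∀ {n} {G : Graph n} {F : LinearForest G} {X : Multiset n} {u z y} → let open Graph G in
          Minimum F → (X ⊕ u ⊕ z) ⊆ₘ End F → z ≡ u ⊎ u ~ z → y ≡ u ⊎ u ~ y → ¬ Free F (X ⊕ u ⊕ z) y
crowded {F = F} {X} {u} {z} {y} min fixed nz ny free = at-most-two {F = F} min nz ny bound
  where
  bound : multiset (u ∷ z ∷ y ∷ []) ⊆ₘ End F
  bound t = ℕ.≤-trans (begin
    multiset (u ∷ z ∷ y ∷ []) t                     ≡⟨ multiset-∷ u (z ∷ y ∷ []) t ⟩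
    𝟙 (t ≟ u) + multiset (z ∷ y ∷ []) t             ≡⟨ cong (𝟙 (t ≟ u) +_) (multiset-two z y t) ⟩
    𝟙 (t ≟ u) + (𝟙 (t ≟ z) + 𝟙 (t ≟ y))             ≡⟨ sym (ℕ.+-assoc (𝟙 (t ≟ u)) _ _) ⟩
    𝟙 (t ≟ u) + 𝟙 (t ≟ z) + 𝟙 (t ≟ y)               ≤⟨ ℕ.+-monoˡ-≤ _ (ℕ.+-monoˡ-≤ _ (ℕ.m≤n+m _ (X t))) ⟩
    X t + 𝟙 (t ≟ u) + 𝟙 (t ≟ z) + 𝟙 (t ≟ y)         ∎) (⊕-⊆ {F = F} {X ⊕ u ⊕ z} fixed free t)
    where open ℕ.≤-Reasoning

-- Deciding reachability in a finite graph

module Reachability {A : Set} {R : A → A → Set} (_≟ₐ_ : DecidableEquality A) (R? : Decidable R) where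

  -- There is a walk from x to y with all intermediate points in the list.
  Via : List A → A → A → Set
  Via []       x y = x ≡ y ⊎ R x y
  Via (z ∷ zs) x y = Via zs x y ⊎ (Via zs x z × Via zs z y)

  via? : ∀ zs → Decidable (Via zs)
  via? []       x y = (x ≟ₐ y) ⊎-dec R? x y
  via? (z ∷ zs) x y = via? zs x y ⊎-dec (via? zs x z ×-dec via? zs z y)

  via⇒star : ∀ zs {x y} → Via zs x y → Star R x y
  via⇒star []       (inj₁ refl)    = ε
  via⇒star []       (inj₂ r)       = r ◅ ε
  via⇒star (z ∷ zs) (inj₁ p)       = via⇒star zs p
  via⇒star (z ∷ zs) (inj₂ (p , q)) = via⇒star zs p ◅◅ via⇒star zs q

  direct : ∀ zs {x y} → x ≡ y ⊎ R x y → Via zs x y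
  direct []       s = s
  direct (_ ∷ zs) s = inj₁ (direct zs s)

  -- Composition is immediate at the head of the list, where x to z and z to y
  -- are recorded separately.
  via-trans : ∀ zs {x y z} → z ∈ₗ zs → Via zs x z → Via zs z y → Via zs x y
  via-trans (z ∷ zs) (here refl) (inj₁ p)       (inj₁ q)       = inj₂ (p , q)
  via-trans (z ∷ zs) (here refl) (inj₁ p)       (inj₂ (_ , q)) = inj₂ (p , q)
  via-trans (z ∷ zs) (here refl) (inj₂ (p , _)) (inj₁ q)       = inj₂ (p , q)
  via-trans (z ∷ zs) (here refl) (inj₂ (p , _)) (inj₂ (_ , q)) = inj₂ (p , q)
  via-trans (z ∷ zs) (there i)   (inj₁ p)       (inj₁ q)       = inj₁ (via-trans zs i p q)
  via-trans (z ∷ zs) (there i)   (inj₁ p)       (inj₂ (q , r)) = inj₂ (via-trans zs i p q , r)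
  via-trans (z ∷ zs) (there i)   (inj₂ (p , q)) (inj₁ r)       = inj₂ (p , via-trans zs i q r)
  via-trans (z ∷ zs) (there i)   (inj₂ (p , _)) (inj₂ (_ , r)) = inj₂ (p , r)

  star⇒via : ∀ {zs} → (∀ {x y} → R x y → y ∈ₗ zs) → ∀ {x y} → Star R x y → Via zs x y
  star⇒via {zs} cover ε       = direct zs (inj₁ refl)
  star⇒via {zs} cover (r ◅ s) = via-trans zs (cover r) (direct zs (inj₂ r)) (star⇒via cover s)

  star? : ∀ zs → (∀ {x y} → R x y → y ∈ₗ zs) → Decidable (Star R)
  star? zs cover x y = map′ (via⇒star zs) (star⇒via cover) (via? zs x y)

-- All lists of length at most k with entries in a given list.
listsUpTo : {A : Set} → ℕ → List A → List (List A)
listsUpTo zero    as = [] ∷ []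
listsUpTo (suc k) as = [] ∷ cartesianProductWith _∷_ as (listsUpTo k as)

∈-listsUpTo : ∀ {A : Set} k {as l : List A} → length l ≤ k → (∀ {x} → x ∈ₗ l → x ∈ₗ as) → l ∈ₗ listsUpTo k as
∈-listsUpTo zero    {l = []}    _       h = here refl
∈-listsUpTo (suc k) {l = []}    _       h = here refl
∈-listsUpTo (suc k) {l = x ∷ l} (s≤s b) h =
  there (∈-cartesianProductWith⁺ _∷_ (h (here refl)) (∈-listsUpTo k b (h ∘ there)))

length-unique : ∀ {n} (l : List (Fin n)) → Unique l → length l ≤ n
length-unique {n} l un = subst₂ _≤_ (size-multiset l) (trans (size-multiset (allFin n)) (length-tabulate id))
                           (sum-mono bound)
  where
  multiset≤1 : ∀ l → Unique l → ∀ v → multiset l v ≤ 1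
  multiset≤1 []      _          v = z≤n
  multiset≤1 (x ∷ l) un@(_ ∷ u) v with v ≟ x
  ... | yes refl = s≤s (ℕ.≤-reflexive (multiset-∉ l (unique-∉ un)))
  ... | no _     = multiset≤1 l u v
  bound : ∀ v → multiset l v ≤ multiset (allFin n) v
  bound v = ℕ.≤-trans (multiset≤1 l un v) (∈-multiset (allFin n) (∈-allFin v))

-- Deciding membership in C(F, X)

module Decide {n : ℕ} {G : Graph n} (X : Multiset n) where
  open Graph G
  open LinearForest

  -- A state of the search is a list of paths, not necessarily forming a
  -- linear forest.
  State : Set
  State = List (List⁺ (Fin n))

  _≟⁺_ : DecidableEquality (List⁺ (Fin n))
  (a ∷ as) ≟⁺ (b ∷ bs) = map′ (λ { (refl , refl) → refl }) (λ { refl → refl , refl })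
                           ((a ≟ b) ×-dec ≡-dec _≟_ as bs)

  -- Paths without repeated vertices have at most n vertices, and a linear
  -- forest has at most n paths.
  states : List State
  states = listsUpTo n (cartesianProductWith List⁺._∷_ (allFin n) (listsUpTo n (allFin n)))

  length-vertices : ∀ (ps : State) → length ps ≤ length (vertices ps)
  length-vertices []       = z≤n
  length-vertices (p ∷ ps) = s≤s (ℕ.≤-trans (length-vertices ps)
    (ℕ.≤-trans (ℕ.m≤n+m _ (length (List⁺.tail p))) (ℕ.≤-reflexive (sym (length-++ (List⁺.tail p))))))

  ∈-states : (F : LinearForest G) → paths F ∈ₗ states
  ∈-states F = ∈-listsUpTo n
    (ℕ.≤-trans (length-vertices (paths F)) (length-unique (vertices (paths F)) (disjoint F)))
    (λ {p} p∈ → ∈-cartesianProductWith⁺ List⁺._∷_ (∈-allFin _)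
      (∈-listsUpTo n (ℕ.≤-trans (ℕ.n≤1+n _) (length-unique (toList p) (unique-path F p∈))) (λ _ → ∈-allFin _)))

  forest? : (P : State) → Dec (∃[ F ] paths {G = G} F ≡ P)
  forest? P = map′ to from
    (All.all? (λ p → linked? _~?_ (toList p)) P ×-dec (unique? _≟_ (vertices P) ×-dec all? (λ v → v ∈? vertices P)))
    where
    to : All (λ p → Linked _~_ (toList p)) P × Unique (vertices P) × (∀ v → v ∈ₗ vertices P) → ∃[ F ] paths {G = G} F ≡ P
    to (a , b , c) = record { paths = P ; inGraph = a ; disjoint = b ; spanning = c } , refl
    from : ∃[ F ] paths {G = G} F ≡ P → All (λ p → Linked _~_ (toList p)) P × Unique (vertices P) × (∀ v → v ∈ₗ vertices P)
    from (F , refl) = inGraph F , disjoint F , spanning F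

  consecutive? : ∀ (q : List (Fin n)) a b → Dec (∃[ xs ] ∃[ ys ] q ≡ xs ++ a ∷ b ∷ ys)
  consecutive? [] a b = no λ { ([] , _ , ()) ; (_ ∷ _ , _ , ()) }
  consecutive? (x ∷ q) a b = map′ to from (start? q ⊎-dec consecutive? q a b)
    where
    Start : List (Fin n) → Set
    Start q = ∃[ ys ] x ∷ q ≡ a ∷ b ∷ ys
    start? : ∀ q → Dec (Start q)
    start? []      = no λ { (_ , ()) }
    start? (y ∷ q) = map′ (λ { (refl , refl) → q , refl }) (λ { (_ , refl) → refl , refl }) ((x ≟ a) ×-dec (y ≟ b))
    to : Start q ⊎ (∃[ xs ] ∃[ ys ] q ≡ xs ++ a ∷ b ∷ ys) → ∃[ xs ] ∃[ ys ] x ∷ q ≡ xs ++ a ∷ b ∷ ys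
    to (inj₁ (ys , e))      = [] , ys , e
    to (inj₂ (xs , ys , e)) = x ∷ xs , ys , cong (x ∷_) e
    from : ∃[ xs ] ∃[ ys ] x ∷ q ≡ xs ++ a ∷ b ∷ ys → Start q ⊎ (∃[ xs ] ∃[ ys ] q ≡ xs ++ a ∷ b ∷ ys)
    from ([] , ys , e)     = inj₁ (ys , e)
    from (_ ∷ xs , ys , e) = inj₂ (xs , ys , ∷-injectiveʳ e)

  samePath? : ∀ (F : LinearForest G) x y → Dec (SamePath F x y)
  samePath? F x y = map′ to from (Any.any? (λ p → (x ∈? toList p) ×-dec (y ∈? toList p)) (paths F))
    where
    to : Any (λ p → x ∈ₗ toList p × y ∈ₗ toList p) (paths F) → SamePath F x y
    to i with p , p∈ , x∈ , y∈ ← find i = p , p∈ , x∈ , y∈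
    from : SamePath F x y → Any (λ p → x ∈ₗ toList p × y ∈ₗ toList p) (paths F)
    from (p , p∈ , x∈ , y∈) = Any.map (λ { refl → x∈ , y∈ }) p∈

  newEnd? : ∀ (F : LinearForest G) v u w → Dec (NewEnd F v u w)
  newEnd? F v u w = map′ to from
    (Any.any? (λ p → fits? (toList p) ⊎-dec fits? (reverse (toList p))) (paths F)
      ⊎-dec (¬? (samePath? F u v) ×-dec edge? F u w))
    where
    Fits : List (Fin n) → Set
    Fits q = (∃[ zs ] q ≡ v ∷ zs) × (∃[ xs ] ∃[ ys ] q ≡ xs ++ w ∷ u ∷ ys)
    starts? : ∀ q → Dec (∃[ zs ] q ≡ v ∷ zs)
    starts? []      = no λ { (_ , ()) }
    starts? (x ∷ q) = map′ (λ { refl → q , refl }) (λ { (_ , refl) → refl }) (x ≟ v)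
    fits? : ∀ q → Dec (Fits q)
    fits? q = starts? q ×-dec consecutive? q w u
    Options : Set
    Options = Any (λ p → Fits (toList p) ⊎ Fits (reverse (toList p))) (paths F) ⊎ (¬ SamePath F u v × Edge F u w)
    to : Options → NewEnd F v u w
    to (inj₂ (apart , e)) = other apart e
    to (inj₁ i) with find i
    ... | p , p∈ , inj₁ ((zs , e) , (xs , ys , e′)) = same (p , p∈ , inj₁ (sym e)) (trans (sym e) e′)
    ... | p , p∈ , inj₂ ((zs , e) , (xs , ys , e′)) = same (p , p∈ , inj₂ (sym e)) (trans (sym e) e′)
    from : NewEnd F v u w → Options
    from (other apart e) = inj₂ (apart , e)
    from (same {xs} {ys} {zs} (p , p∈ , inj₁ e) eq) =
      inj₁ (Any.map (λ { refl → inj₁ ((zs , sym e) , (xs , ys , trans (sym e) eq)) }) p∈)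
    from (same {xs} {ys} {zs} (p , p∈ , inj₂ e) eq) =
      inj₁ (Any.map (λ { refl → inj₂ ((zs , sym e) , (xs , ys , trans (sym e) eq)) }) p∈)

  pair? : ∀ (x y a b : Fin n) → Dec (Pair x y a b)
  pair? x y a b = ((x ≟ a) ×-dec (y ≟ b)) ⊎-dec ((x ≟ b) ×-dec (y ≟ a))

  rewired? : ∀ (F : LinearForest G) v u w F′ → Dec (Rewired F v u w F′)
  rewired? F v u w F′ = all? λ x → all? λ y → map′ (λ { (f , g) → mk⇔ f g })
    (λ e → Equivalence.to e , Equivalence.from e)
    ((edge? F′ x y →-dec after x y) ×-dec (after x y →-dec edge? F′ x y))
    where
    after : ∀ x y → Dec ((Edge F x y × ¬ Pair x y u w) ⊎ Pair x y u v)
    after x y = (edge? F x y ×-dec ¬? (pair? x y u w)) ⊎-dec pair? x y u v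

  rotation? : ∀ (F : LinearForest G) v F′ → Dec (Rotation F v F′)
  rotation? F v F′ = map′
    (λ { (u , w , e , a , ne , rw) → record { endpoint = e ; adjacent = a ; newEnd = ne ; edges = rw } })
    (λ ρ → let open Rotation ρ in u , w , endpoint , adjacent , newEnd , edges)
    (any? λ u → any? λ w → (0 ℕ.<? End F v) ×-dec ((v ~? u) ×-dec (newEnd? F v u w ×-dec rewired? F v u w F′)))

  rotationFixing? : Decidable (RotationFixing {G = G} X)
  rotationFixing? F F′ = any? λ v → (0 ℕ.<? (End F ∖ X) v) ×-dec rotation? F v F′

  -- One rotation fixing X, between forests with the given paths.
  Step : State → State → Set
  Step P P′ = ∃[ F ] ∃[ F′ ] paths F ≡ P × paths F′ ≡ P′ × RotationFixing {G = G} X F F′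

  -- Rotations depend on the paths only, not on the proofs that they form a
  -- linear forest.
  transfer : ∀ {F₁ F₂ F₁′ F₂′ : LinearForest G} → paths F₁ ≡ paths F₁′ → paths F₂ ≡ paths F₂′ →
             RotationFixing {G = G} X F₁ F₂ → RotationFixing X F₁′ F₂′
  transfer {record { paths = P }} {record { paths = Q }} {record { paths = .P }} {record { paths = .Q }}
           refl refl (v , f , ρ) =
    v , f , record { endpoint = endpoint ; adjacent = adjacent ; newEnd = move newEnd ; edges = edges }
    where
    open Rotation ρ
    move : _ → _
    move (same tr eq)    = same tr eq
    move (other apart e) = other apart e

  step? : Decidable Step
  step? P P′ with forest? P | forest? P′
  ... | no ¬F | _     = no λ { (F , _ , e , _) → ¬F (F , e) }
  ... | yes _ | no ¬F = no λ { (_ , F , _ , e , _) → ¬F (F , e) }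
  ... | yes (F , refl) | yes (F′ , refl) = map′ (λ r → F , F′ , refl , refl , r)
    (λ { (F₁ , F₂ , e₁ , e₂ , r) → transfer {F₁} {F₂} {F} {F′} e₁ e₂ r }) (rotationFixing? F F′)

  open Reachability {R = Step} (≡-dec _≟⁺_) step? using (star?)

  family⇒star : ∀ {F F′} → Family {G = G} F X F′ → Star Step (paths F) (paths F′)
  family⇒star ε       = ε
  family⇒star (r ◅ s) = (_ , _ , refl , refl , r) ◅ family⇒star s

  star⇒family : ∀ {F P} → Star Step (paths F) P → ∃[ F′ ] Family {G = G} F X F′ × paths F′ ≡ P
  star⇒family {F} ε = F , ε , refl
  star⇒family {F} ((F₁ , F₂ , e₁ , refl , r) ◅ s) with F′ , fam , e ← star⇒family {F₂} s =
    F′ , transfer {F₁} {F₂} {F} {F₂} e₁ refl r ◅ fam , e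

  -- Later arguments use that C(F, X) is decidable, never how it is decided.
  abstract
    C? : ∀ F → U.Decidable (C {G = G} F X)
    C? F v = map′ to from
      (Any.any? (λ P → star? states cover (paths F) P ×-dec (0 ℕ.<? (multiset (endpoints P) ∖ X) v)) states)
      where
      cover : ∀ {P P′} → Step P P′ → P′ ∈ₗ states
      cover (_ , F′ , _ , refl , _) = ∈-states F′
      Reached : Set
      Reached = Any (λ P → Star Step (paths F) P × v ∈ₘ (multiset (endpoints P) ∖ X)) states
      to : Reached → C F X v
      to i with P , _ , s , free ← find i with F′ , fam , refl ← star⇒family {F} s = F′ , fam , free
      from : C F X v → Reached
      from (F′ , fam , free) = Any.map (λ { refl → family⇒star fam , free }) (∈-states F′)

-- Sizes of the multisets of free endpoints

size-∖ : ∀ {n} {M X : Multiset n} → X ⊆ₘ M → ∣ M ∖ X ∣ₘ + ∣ X ∣ₘ ≡ ∣ M ∣ₘ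
size-∖ {M = M} {X} X⊆ = trans (sym (∑-distrib-+ (M ∖ X) X)) (sum-cong-≗ (λ v → ℕ.m∸n+n≡m (X⊆ v)))

size-∖-⊕ : ∀ {n} {M X : Multiset n} {x} → (X ⊕ x) ⊆ₘ M → ∣ M ∖ (X ⊕ x) ∣ₘ + 1 ≡ ∣ M ∖ X ∣ₘ
size-∖-⊕ {M = M} {X} {x} X⊕x⊆ = begin
  ∣ M ∖ (X ⊕ x) ∣ₘ + 1                        ≡⟨ cong (∣ M ∖ (X ⊕ x) ∣ₘ +_) (sym (count-≡ x)) ⟩
  ∣ M ∖ (X ⊕ x) ∣ₘ + count (_≟ x)             ≡⟨ sym (∑-distrib-+ (M ∖ (X ⊕ x)) (λ t → 𝟙 (t ≟ x))) ⟩
  sum (λ t → (M ∖ (X ⊕ x)) t + 𝟙 (t ≟ x))     ≡⟨ sum-cong-≗ pointwise ⟩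
  ∣ M ∖ X ∣ₘ                                  ∎
  where
  open ≡-Reasoning
  pointwise : ∀ t → M t ∸ (X t + 𝟙 (t ≟ x)) + 𝟙 (t ≟ x) ≡ M t ∸ X t
  pointwise t = trans (cong (_+ 𝟙 (t ≟ x)) (sym (ℕ.∸-+-assoc (M t) (X t) _)))
    (ℕ.m∸n+n≡m (ℕ.m+n≤o⇒m≤o∸n (𝟙 (t ≟ x)) (subst (_≤ M t) (ℕ.+-comm (X t) _) (X⊕x⊆ t))))

family-size : ∀ {n} {G : Graph n} {F F′ : LinearForest G} {X : Multiset n} → Minimum F → X ⊆ₘ End F → Family F X F′ →
              ∣ End F′ ∖ X ∣ₘ ≡ ∣ End F ∖ X ∣ₘ
family-size {F = F} {F′} {X} min X⊆ fam = ℕ.+-cancelʳ-≡ ∣ X ∣ₘ _ _ (begin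
  ∣ End F′ ∖ X ∣ₘ + ∣ X ∣ₘ   ≡⟨ size-∖ {M = End F′} (family-fixed fam X⊆) ⟩
  ∣ End F′ ∣ₘ                ≡⟨ size-End F′ ⟩
  2 * #paths F′              ≡⟨ cong (2 *_) (ℕ.≤-antisym (family-minimum {X = X} fam min F) (min F′)) ⟩
  2 * #paths F               ≡⟨ sym (size-End F) ⟩
  ∣ End F ∣ₘ                 ≡⟨ sym (size-∖ {M = End F} X⊆) ⟩
  ∣ End F ∖ X ∣ₘ + ∣ X ∣ₘ    ∎)
  where open ≡-Reasoning

-- Double counting

𝟙-× : {P Q : Set} (d : Dec P) (e : Dec Q) → 𝟙 (d ×-dec e) ≡ 𝟙 d * 𝟙 e
𝟙-× (yes _) (yes _) = refl
𝟙-× (yes _) (no _)  = refl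
𝟙-× (no _)  (yes _) = refl
𝟙-× (no _)  (no _)  = refl

𝟙-complement : {P : Set} (d : Dec P) → 𝟙 (¬? d) + 𝟙 d ≡ 1
𝟙-complement (yes _) = refl
𝟙-complement (no _)  = refl

count-×ˡ : ∀ {n} {P : Set} {Q : Fin n → Set} (d : Dec P) (Q? : U.Decidable Q) →
           count (λ v → d ×-dec Q? v) ≡ 𝟙 d * count Q?
count-×ˡ d Q? = trans (sum-cong-≗ (λ v → 𝟙-× d (Q? v))) (sym (*-distribˡ-sum (𝟙 d) (𝟙 ∘ Q?)))

double-count : ∀ {n} {P : Fin n → Set} {R : Fin n → Fin n → Set} (P? : U.Decidable P) (R? : Decidable R) →
               sum (λ u → count (λ v → P? v ×-dec R? u v)) ≡ sum (λ v → 𝟙 (P? v) * count (λ u → R? u v))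
double-count P? R? = trans (∑-comm (λ u v → 𝟙 (P? v ×-dec R? u v)))
  (sum-cong-≗ (λ v → count-×ˡ (P? v) (λ u → R? u v)))

-- The lower bound for C(F, X)

module Bound {n : ℕ} (d : ℕ) (G : Graph n) (regular : Graph.Regular G d) where
  open Graph G

  count-~ : ∀ u → count (u ~?_) ≡ d
  count-~ u = trans (sym (length-filter-tabulate (u ~?_) id)) (regular u)

  -- The inequality to be proved, with |C(F, X)| given by counting.
  Holds : LinearForest G → Multiset n → Set
  Holds F X = (d + 1) * ∣ End F ∖ X ∣ₘ ≤ 4 * count (Decide.C? {G = G} X F)

  -- The inequality holds whenever there are fewer free endpoints, but fails
  -- for F and X.
  module _ (F : LinearForest G) (min : Minimum F) (X : Multiset n) (X⊆ : X ⊆ₘ End F)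
           (rec : ∀ F₁ → Minimum F₁ → ∀ X₁ → X₁ ⊆ₘ End F₁ → ∣ End F₁ ∖ X₁ ∣ₘ < ∣ End F ∖ X ∣ₘ → Holds F₁ X₁)
           (fails : 4 * count (Decide.C? X F) < (d + 1) * ∣ End F ∖ X ∣ₘ) where

    open Closure F min X X⊆

    C? : U.Decidable (C F X)
    C? = Decide.C? X F

    -- If X₁ leaves j fewer endpoints of F₁ free, and C(F₁, X₁) and P are disjoint
    -- parts of C(F, X), then P has fewer than (d+1)j/4 elements, as otherwise
    -- the inequality for F₁ and X₁ would imply the one for F and X.
    no-gain : ∀ {F₁ X₁ j} {P : Fin n → Set} (P? : U.Decidable P) → Minimum F₁ → X₁ ⊆ₘ End F₁ →
              ∣ End F₁ ∖ X₁ ∣ₘ + j ≡ ∣ End F ∖ X ∣ₘ → 0 < j →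
              (∀ v → C F₁ X₁ v → C F X v) → (∀ v → P v → C F X v) → (∀ v → P v → ¬ C F₁ X₁ v) →
              4 * count P? < (d + 1) * j
    no-gain {F₁} {X₁} {j} P? min₁ X₁⊆ size 0<j C₁⊆ P⊆ disj = ℕ.≰⇒> λ le → ℕ.<⇒≱ fails (begin
      (d + 1) * ∣ End F ∖ X ∣ₘ                          ≡⟨ cong ((d + 1) *_) (sym size) ⟩
      (d + 1) * (∣ End F₁ ∖ X₁ ∣ₘ + j)                  ≡⟨ ℕ.*-distribˡ-+ (d + 1) ∣ End F₁ ∖ X₁ ∣ₘ j ⟩
      (d + 1) * ∣ End F₁ ∖ X₁ ∣ₘ + (d + 1) * j          ≤⟨ ℕ.+-mono-≤ (rec F₁ min₁ X₁ X₁⊆ smaller) le ⟩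
      4 * count C₁? + 4 * count P?                      ≡⟨ sym (ℕ.*-distribˡ-+ 4 (count C₁?) (count P?)) ⟩
      4 * (count C₁? + count P?)                        ≤⟨ ℕ.*-monoʳ-≤ 4 (count-⊎ C₁? P? C? (λ v c p → disj v p c)
                                                             (λ v → [ C₁⊆ v , P⊆ v ]′)) ⟩
      4 * count C?                                      ∎)
      where
      open ℕ.≤-Reasoning
      C₁? : U.Decidable (C F₁ X₁)
      C₁? = Decide.C? X₁ F₁
      smaller : ∣ End F₁ ∖ X₁ ∣ₘ < ∣ End F ∖ X ∣ₘ
      smaller = subst (∣ End F₁ ∖ X₁ ∣ₘ <_) size (ℕ.m<m+n _ 0<j)

    C-mono : ∀ {F₁ x v} → Family F X F₁ → C F₁ (X ⊕ x) v → C F X v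
    C-mono {x = x} fam (F₂ , fam₂ , free) = F₂ , fam ◅◅ family-⊕ {X = X} {x} fam₂ , free-⊕ {F = F₂} {X} {x} free

    -- The open and the closed neighbourhood of u, within C(F, X).
    N? : ∀ u → U.Decidable (λ v → C F X v × u ~ v)
    N? u v = C? v ×-dec (u ~? v)

    N[]? : ∀ u → U.Decidable (λ v → C F X v × (v ≡ u ⊎ u ~ v))
    N[]? u v = C? v ×-dec ((v ≟ u) ⊎-dec (u ~? v))

    -- The numbers of neighbours of u in C(F, X), in G and along F.
    c f : Fin n → ℕ
    c u = count (N? u)
    f u = count (λ v → C? v ×-dec edge? F u v)

    fixed-size : ∀ {F₁ x} → Family F X F₁ → Free F₁ X x → ∣ End F₁ ∖ (X ⊕ x) ∣ₘ + 1 ≡ ∣ End F ∖ X ∣ₘ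
    fixed-size {F₁} {x} fam free = trans
      (size-∖-⊕ {M = End F₁} {X} (⊕-⊆ {F = F₁} {X} (family-fixed fam X⊆) free)) (family-size {F = F} min X⊆ fam)

    c-none : ∀ {u x} → AtMostOne F u → Guard F u x → x ~ u → C F X x → 4 * c u ≤ d
    c-none {u} {x} one guard x~u cx with F₁ , fam , free , one₁ , guard₁ ← approach one guard x~u cx =
      s≤s⁻¹ (subst (4 * c u <_) (trans (ℕ.*-identityʳ (d + 1)) (ℕ.+-comm d 1))
        (no-gain {F₁} {X ⊕ x} {1} (N? u) (family-minimum {X = X} fam min)
          (⊕-⊆ {F = F₁} {X} (family-fixed fam X⊆) free) (fixed-size fam free) (s≤s z≤n)
          (λ v → C-mono fam) (λ v → proj₁)
          (λ v → λ { (_ , u~v) → frozen fam free one₁ guard₁ x~u (~-sym u~v) })))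

    c-inside : ∀ {u} → C F X u → 2 * c u + 2 ≤ d
    c-inside {u} cu@(F₁ , fam , free) = from-count decide
      where
      min₁ : Minimum F₁
      min₁ = family-minimum {X = X} fam min
      fixed₁ : (X ⊕ u) ⊆ₘ End F₁
      fixed₁ = ⊕-⊆ {F = F₁} {X} (family-fixed fam X⊆) free
      -- Fixing u alone is enough unless a vertex z of its closed neighbourhood
      -- can still become free.
      decide : 4 * count (N[]? u) < (d + 1) * 2
      decide with any? (λ z → Decide.C? (X ⊕ u) F₁ z ×-dec ((z ≟ u) ⊎-dec (u ~? z)))
      ... | no none = ℕ.<-≤-trans
        (no-gain {F₁} {X ⊕ u} {1} (N[]? u) min₁ fixed₁ (fixed-size fam free) (s≤s z≤n) (λ v → C-mono fam) (λ v → proj₁)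
          (λ v → λ { (_ , near) c₁ → none (v , c₁ , near) }))
        (ℕ.*-monoʳ-≤ (d + 1) (s≤s z≤n))
      ... | yes (z , (F₂ , fam₂ , free₂) , nz) =
        no-gain {F₂} {X ⊕ u ⊕ z} {2} (N[]? u) min₂ fixed₂ size (s≤s z≤n)
          (λ v → λ { (F₃ , fam₃ , free₃) → C-mono {x = u} fam (F₃ , fam₂ ◅◅ family-⊕ {X = X ⊕ u} {z} fam₃ ,
                                                                free-⊕ {F = F₃} {X ⊕ u} {z} free₃) })
          (λ v → proj₁)
          (λ v → λ { (_ , near) (F₃ , fam₃ , free₃) →
            crowded {F = F₃} {X} (family-minimum {X = X ⊕ u ⊕ z} fam₃ min₂) (family-fixed fam₃ fixed₂) nz near free₃ })
        where
        min₂ : Minimum F₂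
        min₂ = family-minimum {X = X ⊕ u} fam₂ min₁
        fixed₂ : (X ⊕ u ⊕ z) ⊆ₘ End F₂
        fixed₂ = ⊕-⊆ {F = F₂} {X ⊕ u} (family-fixed fam₂ fixed₁) free₂
        size : ∣ End F₂ ∖ (X ⊕ u ⊕ z) ∣ₘ + 2 ≡ ∣ End F ∖ X ∣ₘ
        size = trans (sym (ℕ.+-assoc _ 1 1)) (trans (cong (_+ 1)
          (trans (size-∖-⊕ {M = End F₂} {X ⊕ u} fixed₂) (family-size {F = F₁} min₁ fixed₁ fam₂))) (fixed-size fam free))
      closed-count : suc (c u) ≤ count (N[]? u)
      closed-count = subst (λ m → m + c u ≤ count (N[]? u)) (count-≡ u)
        (count-⊎ (_≟ u) (N? u) (N[]? u) (λ { v refl (_ , v~v) → ~-irrefl refl v~v })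
          (λ { v (inj₁ refl) → cu , inj₁ refl ; v (inj₂ (cv , u~v)) → cv , inj₂ u~v }))
      from-count : 4 * count (N[]? u) < (d + 1) * 2 → 2 * c u + 2 ≤ d
      from-count lt = s≤s⁻¹ (subst (2 * c u + 2 <_) (ℕ.+-comm d 1)
        (ℕ.*-cancelˡ-< 2 (2 * c u + 2) (d + 1) (ℕ.≤-<-trans (begin
          2 * (2 * c u + 2)      ≡⟨ arith (c u) ⟩
          4 * suc (c u)          ≤⟨ ℕ.*-monoʳ-≤ 4 closed-count ⟩
          4 * count (N[]? u)     ∎) (subst (4 * count (N[]? u) <_) (ℕ.*-comm (d + 1) 2) lt))))
        where
        open ℕ.≤-Reasoning
        arith : ∀ m → 2 * (2 * m + 2) ≡ 4 * suc m
        arith = solve-∀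

    -- The vertices of C(F, X) without neighbours in C(F, X) along F.
    D : Fin n → Set
    D u = C F X u × f u ≡ 0

    D? : U.Decidable D
    D? u = C? u ×-dec (f u ℕ.≟ 0)

    f≡0⇒none : ∀ {u} → f u ≡ 0 → None F u
    f≡0⇒none {u} f≡0 a ca e = ℕ.<⇒≢ (positive-count (λ v → C? v ×-dec edge? F u v) a (ca , e)) (sym f≡0)

    f≤1⇒one : ∀ {u} → f u ≤ 1 → AtMostOne F u
    f≤1⇒one {u} f≤1 a b ca cb ea eb with a ≟ b
    ... | yes a≡b = a≡b
    ... | no a≢b  = contradiction f≤1
      (ℕ.<⇒≱ (two-count (λ v → C? v ×-dec edge? F u v) a b (ca , ea) (cb , eb) a≢b))

    -- After moving the contributions from D, a vertex u keeps its own c(u) if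
    -- it is outside D, and gains its number of neighbours in D if it is in
    -- C(F, X).
    a g : Fin n → ℕ
    a u = 𝟙 (¬? (D? u)) * c u
    g u = count (λ x → D? x ×-dec (C? u ×-dec (x ~? u)))

    pairs : sum a + sum g ≡ sum c
    pairs = begin
      sum a + sum g                                ≡⟨ cong (sum a +_) Σg ⟩
      sum a + sum (λ u → 𝟙 (D? u) * c u)           ≡⟨ sym (∑-distrib-+ a (λ u → 𝟙 (D? u) * c u)) ⟩
      sum (λ u → a u + 𝟙 (D? u) * c u)             ≡⟨ sum-cong-≗ pointwise ⟩
      sum c                                        ∎
      where
      open ≡-Reasoning
      Σg : sum g ≡ sum (λ u → 𝟙 (D? u) * c u)
      Σg = double-count D? (λ u x → C? u ×-dec (x ~? u))
      pointwise : ∀ u → a u + 𝟙 (D? u) * c u ≡ c u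
      pointwise u = trans (sym (ℕ.*-distribʳ-+ (c u) (𝟙 (¬? (D? u))) (𝟙 (D? u))))
        (trans (cong (_* c u) (𝟙-complement (D? u))) (ℕ.*-identityˡ (c u)))

    g≤c : ∀ u → g u ≤ c u
    g≤c u = count-mono (λ x → D? x ×-dec (C? u ×-dec (x ~? u))) (N? u)
      (λ { x ((cx , _) , _ , x~u) → cx , ~-sym x~u })

    twice : ∀ m → 2 * (m + m) ≡ 2 * (2 * m)
    twice = solve-∀

    four : ∀ m → 2 * (m + m) ≡ 4 * m
    four = solve-∀

    many : ∀ {u m} → m ≤ 2 * d → 2 ≤ f u → m ≤ d * f u
    many {u} m≤ 2≤f = ℕ.≤-trans m≤ (ℕ.≤-trans (ℕ.≤-reflexive (ℕ.*-comm 2 d)) (ℕ.*-monoʳ-≤ d 2≤f))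

    c≤d : ∀ u → c u ≤ d
    c≤d u = ℕ.≤-trans (count-mono (N? u) (u ~?_) (λ v → proj₂)) (ℕ.≤-reflexive (count-~ u))

    local-inside : ∀ u → C F X u → ∀ m → f u ≡ suc m → 2 * (c u + g u) ≤ d * f u
    local-inside u cu (suc m) f≡ = many {u} (begin
      2 * (c u + g u)   ≤⟨ ℕ.*-monoʳ-≤ 2 (ℕ.+-monoʳ-≤ (c u) (g≤c u)) ⟩
      2 * (c u + c u)   ≡⟨ twice (c u) ⟩
      2 * (2 * c u)     ≤⟨ ℕ.*-monoʳ-≤ 2 (ℕ.≤-trans (ℕ.m≤m+n _ 2) (c-inside cu)) ⟩
      2 * d             ∎) (subst (2 ≤_) (sym f≡) (s≤s (s≤s z≤n)))
      where open ℕ.≤-Reasoning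
    local-inside u cu zero f≡ = by-g (g u) refl
      where
      open ℕ.≤-Reasoning
      d≡ : d ≡ d * f u
      d≡ = sym (trans (cong (d *_) f≡) (ℕ.*-identityʳ d))
      by-g : ∀ k → g u ≡ k → 2 * (c u + g u) ≤ d * f u
      by-g zero g≡ = begin
        2 * (c u + g u)   ≡⟨ cong (2 *_) (trans (cong (c u +_) g≡) (ℕ.+-identityʳ (c u))) ⟩
        2 * c u           ≤⟨ ℕ.≤-trans (ℕ.m≤m+n _ 2) (c-inside cu) ⟩
        d                 ≡⟨ d≡ ⟩
        d * f u           ∎
      by-g (suc k) g≡ = with-neighbour (count-positive (λ x → D? x ×-dec (C? u ×-dec (x ~? u)))
                                          (subst (0 <_) (sym g≡) (s≤s z≤n)))
        where
        with-neighbour : ∃[ x ] D x × (C F X u × x ~ u) → 2 * (c u + g u) ≤ d * f u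
        with-neighbour (x , (cx , fx≡0) , _ , x~u) = begin
          2 * (c u + g u)   ≤⟨ ℕ.*-monoʳ-≤ 2 (ℕ.+-monoʳ-≤ (c u) (g≤c u)) ⟩
          2 * (c u + c u)   ≡⟨ four (c u) ⟩
          4 * c u           ≤⟨ c-none (f≤1⇒one (ℕ.≤-reflexive f≡)) (inj₂ (f≡0⇒none fx≡0)) x~u cx ⟩
          d                 ≡⟨ d≡ ⟩
          d * f u           ∎

    local-outside : ∀ u → ¬ C F X u → ∀ m → f u ≡ m → ∀ k → c u ≡ k → 2 * c u ≤ d * f u
    local-outside u ¬cu m f≡ zero c≡ = subst (λ k → 2 * k ≤ d * f u) (sym c≡) z≤n
    local-outside u ¬cu (suc (suc m)) f≡ (suc k) c≡ =
      many {u} (ℕ.*-monoʳ-≤ 2 (c≤d u)) (subst (2 ≤_) (sym f≡) (s≤s (s≤s z≤n)))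
    local-outside u ¬cu zero f≡ (suc k) c≡
      with x , cx , u~x ← count-positive (N? u) (subst (0 <_) (sym c≡) (s≤s z≤n)) =
      contradiction (~-sym u~x) (outside-none ¬cu (f≡0⇒none f≡) cx)
    local-outside u ¬cu (suc zero) f≡ (suc k) c≡
      with x , cx , u~x ← count-positive (N? u) (subst (0 <_) (sym c≡) (s≤s z≤n)) = begin
      2 * c u   ≤⟨ ℕ.*-monoˡ-≤ (c u) {2} {4} (s≤s (s≤s z≤n)) ⟩
      4 * c u   ≤⟨ c-none (f≤1⇒one (ℕ.≤-reflexive f≡)) (inj₁ ¬cu) (~-sym u~x) cx ⟩
      d         ≡⟨ sym (trans (cong (d *_) f≡) (ℕ.*-identityʳ d)) ⟩
      d * f u   ∎
      where open ℕ.≤-Reasoning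

    local : ∀ u → 2 * (a u + g u) ≤ d * f u
    local u = by-cases (D? u) (C? u)
      where
      from : ∀ {p q} → a u ≡ p → g u ≡ q → 2 * (p + q) ≤ d * f u → 2 * (a u + g u) ≤ d * f u
      from a≡ g≡ = subst₂ (λ p q → 2 * (p + q) ≤ d * f u) (sym a≡) (sym g≡)
      outside-D : ¬ D u → a u ≡ c u
      outside-D ¬D = trans (cong (_* c u) (𝟙-yes (¬? (D? u)) ¬D)) (ℕ.*-identityˡ (c u))
      by-cases : Dec (D u) → Dec (C F X u) → 2 * (a u + g u) ≤ d * f u
      by-cases (yes Du@(cu , f≡0)) _ = from {0} {0} (trans (cong (λ i → i * c u) (𝟙-no (¬? (D? u)) (λ ¬D → ¬D Du))) (ℕ.*-zeroˡ (c u)))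
        (count-none (λ x → D? x ×-dec (C? u ×-dec (x ~? u)))
          λ { x ((cx , fx≡0) , _ , x~u) → none-independent (f≡0⇒none f≡0) (f≡0⇒none fx≡0) cx x~u }) z≤n
      by-cases (no ¬D) (no ¬cu) = from {q = 0} (outside-D ¬D)
        (count-none (λ x → D? x ×-dec (C? u ×-dec (x ~? u))) λ { x (_ , cu , _) → ¬cu cu })
        (subst (λ m → 2 * m ≤ d * f u) (sym (ℕ.+-identityʳ (c u))) (local-outside u ¬cu (f u) refl (c u) refl))
      by-cases (no ¬D) (yes cu) = from (outside-D ¬D) refl (by-f (f u) refl)
        where
        by-f : ∀ m → f u ≡ m → 2 * (c u + g u) ≤ d * f u
        by-f zero    f≡ = contradiction (cu , f≡) ¬D
        by-f (suc m) f≡ = local-inside u cu m f≡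

    free-endpoint : ∃[ v ] Free F X v
    free-endpoint = sum-positive (End F ∖ X) (positive ∣ End F ∖ X ∣ₘ fails)
      where
      positive : ∀ k {m} → m < (d + 1) * k → 0 < k
      positive zero {m} lt = contradiction (subst (m <_) (ℕ.*-zeroʳ (d + 1)) lt) ℕ.n≮0
      positive (suc k)  lt = s≤s z≤n

    degree≤2 : ∀ v → degreeᶠ F v ≤ 2
    degree≤2 v = subst (degreeᶠ F v ≤_) (End+degree F v) (ℕ.m≤n+m _ (End F v))

    end-degree<2 : ∀ {v} → v ∈ₘ End F → degreeᶠ F v < 2
    end-degree<2 {v} v∈ = subst (degreeᶠ F v <_) (End+degree F v) (ℕ.+-monoˡ-≤ (degreeᶠ F v) v∈)

    Σc : sum c ≡ d * count C?
    Σc = begin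
      sum c                                          ≡⟨ double-count C? _~?_ ⟩
      sum (λ v → 𝟙 (C? v) * count (λ u → u ~? v))    ≡⟨ sum-cong-≗ (λ v → trans (cong (𝟙 (C? v) *_) (indegree v))
                                                                                (ℕ.*-comm (𝟙 (C? v)) d)) ⟩
      sum (λ v → d * 𝟙 (C? v))                       ≡⟨ sym (*-distribˡ-sum d (𝟙 ∘ C?)) ⟩
      d * count C?                                   ∎
      where
      open ≡-Reasoning
      indegree : ∀ v → count (λ u → u ~? v) ≡ d
      indegree v = trans (count-cong (λ u → u ~? v) (v ~?_) (λ u → ~-sym) (λ u → ~-sym)) (count-~ v)

    Σf : sum f < 2 * count C?
    Σf = begin-strict
      sum f                                                ≡⟨ double-count C? (edge? F) ⟩
      sum (λ v → 𝟙 (C? v) * count (λ u → edge? F u v))     ≡⟨ sum-cong-≗ (λ v → cong (𝟙 (C? v) *_) (indegree v)) ⟩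
      sum (λ v → 𝟙 (C? v) * degreeᶠ F v)                   <⟨ sum-mono-< (λ v → ℕ.*-monoʳ-≤ (𝟙 (C? v)) (degree≤2 v)) v₀ strictly ⟩
      sum (λ v → 𝟙 (C? v) * 2)                             ≡⟨ sum-cong-≗ (λ v → ℕ.*-comm (𝟙 (C? v)) 2) ⟩
      sum (λ v → 2 * 𝟙 (C? v))                             ≡⟨ sym (*-distribˡ-sum 2 (𝟙 ∘ C?)) ⟩
      2 * count C?                                         ∎
      where
      open ℕ.≤-Reasoning
      indegree : ∀ v → count (λ u → edge? F u v) ≡ degreeᶠ F v
      indegree v = count-cong (λ u → edge? F u v) (edge? F v) (λ u → Edge-sym F) (λ u → Edge-sym F)
      v₀ : Fin n
      v₀ = proj₁ free-endpoint
      strictly : 𝟙 (C? v₀) * degreeᶠ F v₀ < 𝟙 (C? v₀) * 2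
      strictly = subst (λ m → m * degreeᶠ F v₀ < m * 2) (sym (𝟙-yes (C? v₀) (F , ε , proj₂ free-endpoint)))
        (subst (_< 2) (sym (ℕ.*-identityˡ _)) (end-degree<2 (free⇒end {F = F} {X} (proj₂ free-endpoint))))

    contradictory : ⊥
    contradictory = ℕ.<-irrefl refl (begin-strict
      d * (2 * count C?)               ≡⟨ swap d (count C?) ⟩
      2 * (d * count C?)               ≡⟨ cong (2 *_) (sym Σc) ⟩
      2 * sum c                        ≡⟨ cong (2 *_) (sym pairs) ⟩
      2 * (sum a + sum g)              ≡⟨ cong (2 *_) (sym (∑-distrib-+ a g)) ⟩
      2 * sum (λ u → a u + g u)        ≡⟨ *-distribˡ-sum 2 (λ u → a u + g u) ⟩
      sum (λ u → 2 * (a u + g u))      ≤⟨ sum-mono local ⟩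
      sum (λ u → d * f u)              ≡⟨ sym (*-distribˡ-sum d f) ⟩
      d * sum f                        <⟨ scale d d>0 Σf ⟩
      d * (2 * count C?)               ∎)
      where
      open ℕ.≤-Reasoning
      swap : ∀ k m → k * (2 * m) ≡ 2 * (k * m)
      swap = solve-∀
      d>0 : 0 < d
      d>0 = ℕ.<-≤-trans (s≤s z≤n) (ℕ.≤-trans (ℕ.m≤n+m 2 (2 * c (proj₁ free-endpoint)))
              (c-inside (F , ε , proj₂ free-endpoint)))
      scale : ∀ k {p q} → 0 < k → p < q → k * p < k * q
      scale (suc k) _ = ℕ.*-monoʳ-< (suc k)

  bound : ∀ k F → Minimum F → ∀ X → X ⊆ₘ End F → ∣ End F ∖ X ∣ₘ ≡ k → Holds F X
  bound = <-rec _ λ k rec F min X X⊆ size →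
    ℕ.≮⇒≥ (contradictory F min X X⊆
      (λ F₁ min₁ X₁ X₁⊆ smaller → rec (subst (_ <_) size smaller) F₁ min₁ X₁ X₁⊆ refl))

lemma2p3 : ∀ (n d : ℕ) (G : Graph n) → Graph.Regular G d →
    ∀ (F : LinearForest G) → Minimum F →
    ∀ (X : Multiset n) → X ⊆ₘ End F →
    ∃[ S ] (∀ v → v ∈ S ⇔ C F X v) × ((d + 1) * ∣ End F ∖ X ∣ₘ ≤ 4 * ∣ S ∣)
lemma2p3 n d G regular F min X X⊆ = _ , ∈-subset C? ,
  subst (λ m → (d + 1) * ∣ End F ∖ X ∣ₘ ≤ 4 * m) (sym (count-subset C?)) (Bound.bound d G regular ∣ End F ∖ X ∣ₘ F min X X⊆ refl)
  where
  C? : U.Decidable (C F X)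
  C? = Decide.C? X F
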